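{- Let $\varphi(x)=\sum_{i\ge0}\gamma_ix^i\in\mathbb{K}[[x]]$, let $r\in\mathbb{Z}$, and stipulate $\gamma_i=0$ for $i<0$. Then $\varphi\in\mathcal{F}_r$ if and only if the following hold. If $r=2k$ is even: for each $n\ge\max\{0,-k\}$, $$\gamma_{2n+1}=\sum_{i=-k}^n{n+k\brack i+k}\gamma_{2i},$$ and, if $k<0$, then for $0\le n\le -k-1$, $$\gamma_{2n+1}=\sum_{i=0}^n-{ -k-i\brack -k-n}\gamma_{2i}.$$ If $r=2k+1$ is odd: for each $n\ge\max\{0,-k\}$, $$\gamma_{2n+1}=\sum_{i=-k}^n{n+k\brace i+k}\gamma_{2i},$$ and, if $k<0$, then for $0\le n\le -k-1$, $$\gamma_{2n+1}=\sum_{i=0}^n-{ -k-i-1\brace -k-n-1}\gamma_{2i}.$$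
   Context: $\mathbb{K}\in\{\mathbb{Q},\mathbb{R},\mathbb{C}\}$. For $r\in\mathbb{Z}$, $\mathcal{F}_r$ denotes the space of $\varphi\in\mathbb{K}[[x]]$ with $\varphi(x/(x-1))=(1-x)^r\varphi(x)$. The Euler polynomials $E_n(x)$ are defined by $\frac{2e^{xt}}{e^t+1}=\sum_{n\ge0}E_n(x)\frac{t^n}{n!}$. For integers $N\ge0$, define ${N\brack j}$ by $\sum_{j=1}^N{N\brack j}x^{2j-1}=x^{2N}-E_{2N}(x)$ and ${N\brace j}$ by $\sum_{j=0}^N{N\brace j}x^{2j}=x^{2N+1}-E_{2N+1}(x)$ (negatives of the odd-degree coefficients of $E_{2N}$, resp. even-degree coefficients of $E_{2N+1}$); set ${N\brack j}=0$ for $j\le0$ or $j>N$, and ${N\brace j}=0$ for $j<0$ or $j>N$. -}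

module Defs where

open import Algebra.Bundles using (CommutativeRing)
open import Algebra.Bundles.Raw using (RawRing)
import Algebra.Definitions.RawSemiring as RawSemiringDefs
open import Data.Fin.Base using (toℕ)
open import Data.Integer.Base as ℤ using (ℤ; +_; -[1+_])
open import Data.Nat.Base as ℕ using (ℕ; zero; suc; _∸_; _!)
open import Data.Nat.Properties using (_!≢0; _≤?_)
open import Data.Rational.Base as ℚ using (ℚ; 0ℚ; ½)
open import Relation.Nullary.Decidable.Core using (yes; no)

-- R⟦x⟧, a series being its sequence of coefficients.
module _ {c ℓ} (R : RawRing c ℓ) where
  private
    module R where
      open RawRing R public
      open RawSemiringDefs rawSemiring public using (sum)

  constant : R.Carrier → ℕ → R.Carrier
  constant a zero    = a
  constant a (suc _) = R.0#

  powerSeries : RawRing c ℓ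
  powerSeries = record
    { Carrier = ℕ → R.Carrier
    ; _≈_     = λ f g → ∀ n → f n R.≈ g n
    ; _+_     = λ f g n → f n R.+ g n
    ; _*_     = λ f g n → R.sum {suc n} (λ i → f (toℕ i) R.* g (n ∸ toℕ i))
    ; -_      = λ f n → R.- f n
    ; 0#      = λ _ → R.0#
    ; 1#      = constant R.1#
    }

  private
    module S where
      open RawRing powerSeries public
      open RawSemiringDefs rawSemiring public using (_^_)

  X : S.Carrier
  X 1 = R.1#
  X _ = R.0#

  -- The quotient f / g by long division, where u must be the inverse of the
  -- constant term of g:  f/g = q + x·((f - q·g)/x)/g  with  q = u·f(0).
  divide : R.Carrier → S.Carrier → S.Carrier → S.Carrier
  divide u f g zero    = u R.* f 0
  divide u f g (suc n) =
    divide u (λ m → f (suc m) R.+ R.- ((u R.* f 0) R.* g (suc m))) g n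

  -- f(g(x)), where g must have zero constant term, so that gⁱ does not
  -- contribute to the coefficient of xⁿ for i > n.
  compose : S.Carrier → S.Carrier → S.Carrier
  compose f g n = R.sum {suc n} (λ i → f (toℕ i) R.* (g S.^ toℕ i) n)

-- Polynomials in ℚ[x] are treated as elements of ℚ⟦x⟧, and 2eˣᵗ/(eᵗ+1) as a
-- series in t over ℚ⟦x⟧.
ℚ⟦x⟧ : RawRing _ _
ℚ⟦x⟧ = powerSeries ℚ.+-*-rawRing

module ℚ⟦x⟧ where
  open RawRing ℚ⟦x⟧ public
  open RawSemiringDefs rawSemiring public using (_^_)

  x : Carrier
  x = X ℚ.+-*-rawRing

  const : ℚ → Carrier
  const = constant ℚ.+-*-rawRing

ℚ⟦x⟧⟦t⟧ : RawRing _ _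
ℚ⟦x⟧⟦t⟧ = powerSeries ℚ⟦x⟧

private
  module ℚ⟦x⟧⟦t⟧ = RawRing ℚ⟦x⟧⟦t⟧

1/_! : ℕ → ℚ
1/ n ! = ℚ._/_ (+ 1) (n !) {{n !≢0}}

-- exp(y t) for y ∈ ℚ⟦x⟧
exp[_t] : ℚ⟦x⟧.Carrier → ℚ⟦x⟧⟦t⟧.Carrier
exp[ y t] n = ℚ⟦x⟧.const (1/ n !) ℚ⟦x⟧.* (y ℚ⟦x⟧.^ n)

eulerGF : ℚ⟦x⟧⟦t⟧.Carrier
eulerGF = divide ℚ⟦x⟧ (ℚ⟦x⟧.const ½) (2# * exp[ ℚ⟦x⟧.x t]) (exp[ ℚ⟦x⟧.1# t] + 1#)
  where
    open ℚ⟦x⟧⟦t⟧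
    2# : Carrier
    2# = 1# + 1#

E : ℕ → ℚ⟦x⟧.Carrier
E n = ℚ⟦x⟧.const (+ (n !) ℚ./ 1) ℚ⟦x⟧.* eulerGF n

-- xⁿ - Eₙ(x)
x^_-E : ℕ → ℚ⟦x⟧.Carrier
x^ n -E = (ℚ⟦x⟧.x ℚ⟦x⟧.^ n) ℚ⟦x⟧.+ (ℚ⟦x⟧.- E n)

-- brack N j is [N j] and brace N j is {N j}; the value at N < 0, where they are
-- undefined, is junk.
brack : ℤ → ℤ → ℚ
brack (+ N) (+ suc j) with suc j ≤? N
... | yes _ = (x^ 2 ℕ.* N -E) (2 ℕ.* suc j ∸ 1)
... | no  _ = 0ℚ
brack _ _ = 0ℚ

brace : ℤ → ℤ → ℚ
brace (+ N) (+ j) with j ≤? N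
... | yes _ = (x^ 2 ℕ.* N ℕ.+ 1 -E) (2 ℕ.* j)
... | no  _ = 0ℚ
brace _ _ = 0ℚ

module Over {c ℓ} (K : CommutativeRing c ℓ) where
  open CommutativeRing K using (Carrier; 0#; 1#; -_; rawRing)
  open RawSemiringDefs (RawRing.rawSemiring rawRing) using (sum)

  K⟦x⟧ : RawRing c ℓ
  K⟦x⟧ = powerSeries rawRing

  private
    module S where
      open RawRing K⟦x⟧ public
      open RawSemiringDefs (RawRing.rawSemiring K⟦x⟧) public using (_^_)

    x : S.Carrier
    x = X rawRing

  1-x : S.Carrier
  1-x = S.1# S.+ (S.- x)

  x-1 : S.Carrier
  x-1 = x S.+ (S.- S.1#)

  x/[x-1] : S.Carrier
  x/[x-1] = divide rawRing (- 1#) x x-1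

  [1-x]^_ : ℤ → S.Carrier
  [1-x]^ (+ m)    = 1-x S.^ m
  [1-x]^ -[1+ m ] = divide rawRing 1# S.1# 1-x S.^ suc m

  𝓕 : ℤ → S.Carrier → Set ℓ
  𝓕 r φ = compose rawRing φ x/[x-1] S.≈ ([1-x]^ r) S.* φ

  -- γᵢ for i ∈ ℤ, with γᵢ = 0 for i < 0
  _⟨_⟩ : (ℕ → Carrier) → ℤ → Carrier
  γ ⟨ + i ⟩      = γ i
  γ ⟨ -[1+ _ ] ⟩ = 0#

  -- The sum of f i over a ≤ i ≤ b, empty if b < a.
  ∑ : ℤ → ℤ → (ℤ → Carrier) → Carrier
  ∑ a b f with b ℤ.- a
  ... | + m      = sum {suc m} (λ j → f (a ℤ.+ + toℕ j))
  ... | -[1+ _ ] = 0#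

  infix 5 ∑
  syntax ∑ a b (λ i → e) = ∑[ a ≤ i ≤ b ] e

{-# OPTIONS --safe #-}
-- For a series f(t) let M f be the operator
--   (M f γ)ₙ = Σ_{i≤n} (r+i)(r+i+1)⋯(r+n-1) fₙ₋ᵢ γᵢ.
-- The weights telescope, so M f ∘ M g = M (f g), and the sign change
-- (σ γ)ₙ = (-1)ⁿ γₙ satisfies σ (M f γ) = M (f(-t)) (σ γ).  Expanding
-- (1-x)^(-r) φ(x/(x-1)) by the binomial series, φ ∈ 𝓕ᵣ says that
-- M eᵗ (σ γ) = γ.  For ε(t) = 2/(eᵗ+1) we have ε(-t) = ε(t) eᵗ, hence
-- σ (M ε γ) = M ε (M eᵗ (σ γ)); since M ε is invertible, φ ∈ 𝓕ᵣ iff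
-- σ (M ε γ) = M ε γ, i.e. iff (M ε γ)₂ₙ₊₁ = 0 for all n.  As ε has no even
-- coefficients besides ε₀ = 1, this equation expresses γ₂ₙ₊₁ through the γ₂ᵢ
-- with i ≤ n, and Eₘ(x) = Σⱼ (m!/j!) εₘ₋ⱼ xʲ identifies the coefficients.  The
-- case distinction for negative r arises because the weight vanishes when
-- r+2i ≤ 0 ≤ r+2n and changes sign when both ends are negative.
module Submission where

open import Algebra.Bundles using (CommutativeRing)
open import Algebra.Bundles.Raw using (RawRing)
import Algebra.Construct.Pointwise as Pointwise
import Algebra.Definitions.RawSemiring as RawSemiringDefs
open import Algebra.Morphism.Structures using (IsRingHomomorphism)
import Algebra.Properties.AbelianGroup as AbelianGroupProperties
import Algebra.Properties.CommutativeSemigroup as CommutativeSemigroupProperties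
import Algebra.Properties.Group as GroupProperties
import Algebra.Properties.Monoid.Sum as MonoidSum
import Algebra.Properties.Ring as RingProperties
open import Data.Fin.Base using (toℕ)
import Data.Fin.Properties as Fin
open import Data.Integer.Base as ℤ using (ℤ; +_; -[1+_])
import Data.Integer.DivMod as ℤ
import Data.Integer.Properties as ℤ
import Data.Integer.Solver as ℤ-Solver
open import Data.Nat.Base as ℕ using (ℕ; zero; suc; _!)
import Data.Nat.Properties as ℕ
import Data.Nat.Solver as ℕ-Solver
open import Data.Product.Base using (_×_; _,_; ∃; proj₁; proj₂)
open import Data.Rational.Base as ℚ using (ℚ; 0ℚ; 1ℚ; ½; _/_; fromℚᵘ; toℚᵘ; +-*-rawRing)
import Data.Rational.Properties as ℚ
import Data.Rational.Solver as ℚ-Solver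
open import Data.Rational.Unnormalised.Base as ℚᵘ using (mkℚᵘ; *≡*)
import Data.Rational.Unnormalised.Properties as ℚᵘ
open import Data.Sum.Base using (_⊎_; inj₁; inj₂; [_,_]′)
open import Function.Bundles using (_⇔_; mk⇔)
open import Relation.Binary.PropositionalEquality.Core using (_≡_)
import Relation.Binary.PropositionalEquality as ≡
import Relation.Binary.Reasoning.Setoid as ≈-Reasoning
open import Relation.Nullary.Decidable.Core using (yes; no)
open import Relation.Nullary.Negation.Core using (contradiction)
open import Defs

-- Formal power series

-- The weight (r+i)⋯(r+n-1) is formally Γ(r+n)/Γ(r+i), so `M f` is multiplication by f(t),
-- conjugated by the scaling of the n-th coefficient by Γ(r+n). These Gamma values have poles for r
-- ≤ 0; keeping their quotients as finite products inside `M` treats all r ∈ ℤ at once. Every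
-- invertible ε with ε(-t) = ε(t) eᵗ turns membership in 𝓕ᵣ into a parity condition; such ε are the
-- series e^(-t/2) h(t) with h even. The choice h(t) = 1/cosh(t/2) gives ε(t) = 1 - tanh(t/2), whose
-- only term of even degree is the constant one. This is why the equation for γ₂ₙ₊₁ contains no
-- other γ of odd index.

module PowerSeries {c ℓ} (R : CommutativeRing c ℓ) where
  open CommutativeRing R hiding (zero)
  open CommutativeSemigroupProperties +-commutativeSemigroup using (interchange; x∙yz≈y∙xz)
  open CommutativeSemigroupProperties *-commutativeSemigroup using () renaming (x∙yz≈y∙xz to x*yz≈y*xz)
  open RingProperties ring using (-‿distribˡ-*; -0#≈0#)
  open ≈-Reasoning setoid

  Series : Set c
  Series = ℕ → Carrier

  open RawRing (powerSeries rawRing) public using ()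
    renaming (_≈_ to _≋_; _+_ to _⊕_; _*_ to _⊛_; -_ to ⊖_; 0# to 𝟘; 1# to 𝟙)

  tail : Series → Series
  tail f n = f (suc n)

  _·_ : Carrier → Series → Series
  (a · f) n = a * f n

  infixr 7 _·_

  -- The finite sum in the product unfolds definitionally: `(f ⊛ g) (suc n)` is
  -- `f 0 * g (suc n) + (tail f ⊛ g) n`, and degree zero carries a trailing `0#`. The inductions on
  -- products below follow this recursion.
  ⊛-cong : ∀ {f f′ g g′} → f ≋ f′ → g ≋ g′ → f ⊛ g ≋ f′ ⊛ g′
  ⊛-cong p q zero    = +-congʳ (*-cong (p 0) (q 0))
  ⊛-cong p q (suc n) = +-cong (*-cong (p 0) (q (suc n))) (⊛-cong (λ i → p (suc i)) q n)

  ⊛-congʳ : ∀ {f f′} g → f ≋ f′ → f ⊛ g ≋ f′ ⊛ g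
  ⊛-congʳ g f≈f′ = ⊛-cong {g = g} f≈f′ (λ _ → refl)

  ⊛-congˡ : ∀ f {g g′} → g ≋ g′ → f ⊛ g ≋ f ⊛ g′
  ⊛-congˡ f g≈g′ = ⊛-cong {f = f} (λ _ → refl) g≈g′

  ⊛-distribʳ : ∀ h f g → (f ⊕ g) ⊛ h ≋ (f ⊛ h) ⊕ (g ⊛ h)
  ⊛-distribʳ h f g zero = begin
    (f 0 + g 0) * h 0 + 0#                ≈⟨ +-cong (distribʳ _ _ _) (sym (+-identityˡ 0#)) ⟩
    (f 0 * h 0 + g 0 * h 0) + (0# + 0#)   ≈⟨ interchange _ _ _ _ ⟩
    (f 0 * h 0 + 0#) + (g 0 * h 0 + 0#)   ∎
  ⊛-distribʳ h f g (suc n) =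
    trans (+-cong (distribʳ _ _ _) (⊛-distribʳ h (tail f) (tail g) n)) (interchange _ _ _ _)

  ·-⊛ : ∀ a f g → (a · f) ⊛ g ≋ a · (f ⊛ g)
  ·-⊛ a f g zero = begin
    (a * f 0) * g 0 + 0#        ≈⟨ +-cong (*-assoc _ _ _) (sym (zeroʳ a)) ⟩
    a * (f 0 * g 0) + a * 0#    ≈⟨ distribˡ _ _ _ ⟨
    a * (f 0 * g 0 + 0#)        ∎
  ·-⊛ a f g (suc n) =
    trans (+-cong (*-assoc _ _ _) (·-⊛ a (tail f) g n)) (sym (distribˡ _ _ _))

  -- The mirror image of the defining recursion, with the tail taken in the right factor.
  -- Commutativity compares the two recursions.
  ⊛-suc : ∀ f g n → (f ⊛ g) (suc n) ≈ f (suc n) * g 0 + (f ⊛ tail g) n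
  ⊛-suc f g zero    = x∙yz≈y∙xz _ _ _
  ⊛-suc f g (suc n) = trans (+-congˡ (⊛-suc (tail f) g n)) (x∙yz≈y∙xz _ _ _)

  ⊛-comm : ∀ f g → f ⊛ g ≋ g ⊛ f
  ⊛-comm f g zero    = +-congʳ (*-comm _ _)
  ⊛-comm f g (suc n) = trans (+-cong (*-comm _ _) (⊛-comm (tail f) g n)) (sym (⊛-suc g f n))

  ⊛-assoc : ∀ f g h → (f ⊛ g) ⊛ h ≋ f ⊛ (g ⊛ h)
  ⊛-assoc f g h zero = +-congʳ (begin
    (f 0 * g 0 + 0#) * h 0    ≈⟨ *-congʳ (+-identityʳ _) ⟩
    (f 0 * g 0) * h 0         ≈⟨ *-assoc _ _ _ ⟩
    f 0 * (g 0 * h 0)         ≈⟨ *-congˡ (+-identityʳ _) ⟨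
    f 0 * (g 0 * h 0 + 0#)    ∎)
  ⊛-assoc f g h (suc n) = begin
    (f 0 * g 0 + 0#) * h (suc n) + (((f 0 · tail g) ⊕ (tail f ⊛ g)) ⊛ h) n
      ≈⟨ +-cong (trans (*-congʳ (+-identityʳ _)) (*-assoc _ _ _)) (⊛-distribʳ h (f 0 · tail g) (tail f ⊛ g) n) ⟩
    f 0 * (g 0 * h (suc n)) + (((f 0 · tail g) ⊛ h) n + ((tail f ⊛ g) ⊛ h) n)
      ≈⟨ +-congˡ (+-cong (·-⊛ (f 0) (tail g) h n) (⊛-assoc (tail f) g h n)) ⟩
    f 0 * (g 0 * h (suc n)) + (f 0 * (tail g ⊛ h) n + (tail f ⊛ (g ⊛ h)) n)
      ≈⟨ +-assoc _ _ _ ⟨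
    (f 0 * (g 0 * h (suc n)) + f 0 * (tail g ⊛ h) n) + (tail f ⊛ (g ⊛ h)) n
      ≈⟨ +-congʳ (distribˡ _ _ _) ⟨
    f 0 * (g 0 * h (suc n) + (tail g ⊛ h) n) + (tail f ⊛ (g ⊛ h)) n ∎

  𝟘-⊛ : ∀ f → 𝟘 ⊛ f ≋ 𝟘
  𝟘-⊛ f zero    = trans (+-identityʳ _) (zeroˡ _)
  𝟘-⊛ f (suc n) = trans (+-cong (zeroˡ _) (𝟘-⊛ f n)) (+-identityʳ _)

  constant-⊛ : ∀ a f → constant rawRing a ⊛ f ≋ a · f
  constant-⊛ a f zero    = +-identityʳ _
  constant-⊛ a f (suc n) = trans (+-congˡ (𝟘-⊛ f n)) (+-identityʳ _)

  𝟙-⊛ : ∀ f → 𝟙 ⊛ f ≋ f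
  𝟙-⊛ f n = trans (constant-⊛ 1# f n) (*-identityˡ _)

  powerSeriesRing : CommutativeRing c ℓ
  powerSeriesRing = record
    { _≈_ = _≋_
    ; _+_ = _⊕_
    ; _*_ = _⊛_
    ; -_  = ⊖_
    ; 0#  = 𝟘
    ; 1#  = 𝟙
    ; isCommutativeRing = record
      { isRing = record
        { +-isAbelianGroup = Pointwise.isAbelianGroup ℕ +-isAbelianGroup
        ; *-cong           = ⊛-cong
        ; *-assoc          = ⊛-assoc
        ; *-identity       = 𝟙-⊛ , λ f n → trans (⊛-comm f 𝟙 n) (𝟙-⊛ f n)
        ; distrib          = (λ f g h n → trans (⊛-comm f (g ⊕ h) n) (trans (⊛-distribʳ f g h n)
                                 (+-cong (⊛-comm g f n) (⊛-comm h f n))))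
                           , ⊛-distribʳ
        }
      ; *-comm = ⊛-comm
      }
    }

  private
    module S = CommutativeRing powerSeriesRing

  ⊛-cancelʳ-invertible : ∀ {f g h v} → h ⊛ v ≋ 𝟙 → f ⊛ h ≋ g ⊛ h → f ≋ g
  ⊛-cancelʳ-invertible {f} {g} {h} {v} hv≈1 fh≈gh = S.trans (S.sym (expand f))
      (S.trans (⊛-congʳ v fh≈gh) (expand g))
    where
    expand : ∀ k → (k ⊛ h) ⊛ v ≋ k
    expand k = S.trans (S.*-assoc k h v) (S.trans (⊛-congˡ k hv≈1) (S.*-identityʳ k))

  ⊛-cancelˡ-invertible : ∀ {f g h v} → h ⊛ v ≋ 𝟙 → h ⊛ f ≋ h ⊛ g → f ≋ g
  ⊛-cancelˡ-invertible {f} {g} {h} hv≈1 hf≈hg =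
    ⊛-cancelʳ-invertible hv≈1 (S.trans (S.*-comm f h) (S.trans hf≈hg (S.*-comm h g)))

  -- Induction on the degree with the dividend varying: the remainder `f-qg` of one division step is
  -- the next dividend, and adding back `q * g (suc n)` restores f.
  divide-⊛ : ∀ u f g → u * g 0 ≈ 1# → divide rawRing u f g ⊛ g ≋ f
  divide-⊛ u f g ug₀≈1 zero = begin
    u * f 0 * g 0 + 0#   ≈⟨ +-identityʳ _ ⟩
    u * f 0 * g 0        ≈⟨ *-congʳ (*-comm _ _) ⟩
    f 0 * u * g 0        ≈⟨ *-assoc _ _ _ ⟩
    f 0 * (u * g 0)      ≈⟨ *-congˡ ug₀≈1 ⟩
    f 0 * 1#             ≈⟨ *-identityʳ _ ⟩
    f 0                  ∎
  divide-⊛ u f g ug₀≈1 (suc n) = begin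
    q * g (suc n) + (divide rawRing u f-qg g ⊛ g) n    ≈⟨ +-congˡ (divide-⊛ u f-qg g ug₀≈1 n) ⟩
    q * g (suc n) + (f (suc n) + - (q * g (suc n)))    ≈⟨ x∙yz≈y∙xz _ _ _ ⟩
    f (suc n) + (q * g (suc n) + - (q * g (suc n)))    ≈⟨ +-congˡ (-‿inverseʳ _) ⟩
    f (suc n) + 0#                                     ≈⟨ +-identityʳ _ ⟩
    f (suc n)                                          ∎
    where
    q : Carrier
    q = u * f 0
    f-qg : Series
    f-qg m = f (suc m) + - (q * g (suc m))

  divide-unique : ∀ u f g h → u * g 0 ≈ 1# → h ⊛ g ≋ f → divide rawRing u f g ≋ h
  divide-unique u f g h ug₀≈1 hg≈f =
    ⊛-cancelʳ-invertible {v = divide rawRing u 𝟙 g}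
      (S.trans (S.*-comm g _) (divide-⊛ u 𝟙 g ug₀≈1))
      (S.trans (divide-⊛ u f g ug₀≈1) (S.sym hg≈f))

  x : Series
  x = X rawRing

  x-⊛-zero : ∀ f → (x ⊛ f) 0 ≈ 0#
  x-⊛-zero f = trans (+-identityʳ _) (zeroˡ _)

  x-⊛-suc : ∀ f n → (x ⊛ f) (suc n) ≈ f n
  x-⊛-suc f n = begin
    0# * f (suc n) + (tail x ⊛ f) n   ≈⟨ trans (+-congʳ (zeroˡ _)) (+-identityˡ _) ⟩
    (tail x ⊛ f) n                    ≈⟨ ⊛-congʳ f tail-x n ⟩
    (𝟙 ⊛ f) n                         ≈⟨ 𝟙-⊛ f n ⟩
    f n                               ∎
    where
    tail-x : tail x ≋ 𝟙
    tail-x zero    = refl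
    tail-x (suc _) = refl

  constant-isRingHomomorphism :
    IsRingHomomorphism rawRing (powerSeries rawRing) (constant rawRing)
  constant-isRingHomomorphism = record
    { isSemiringHomomorphism = record
      { isNearSemiringHomomorphism = record
        { +-isMonoidHomomorphism = record
          { isMagmaHomomorphism = record
            { isRelHomomorphism = record { cong = λ { a≈b zero → a≈b ; a≈b (suc _) → refl } }
            ; homo = λ { a b zero → refl ; a b (suc _) → sym (+-identityˡ 0#) }
            }
          ; ε-homo = λ { zero → refl ; (suc _) → refl }
          }
        ; *-homo = λ { a b zero    → sym (constant-⊛ a (constant rawRing b) zero)
                     ; a b (suc n) → trans (sym (zeroʳ a)) (sym (constant-⊛ a (constant rawRing b) (suc n))) }
        }
      ; 1#-homo = λ _ → refl
      }
    ; -‿homo = λ { a zero → refl ; a (suc _) → sym -0#≈0# }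
    }

  open RawSemiringDefs (RawRing.rawSemiring (powerSeries rawRing)) using (_^_)

  𝟙^ : ∀ n → 𝟙 ^ n ≋ 𝟙
  𝟙^ zero    _ = refl
  𝟙^ (suc n) m = trans (𝟙-⊛ (𝟙 ^ n) m) (𝟙^ n m)

  x^-coefficient : ∀ j l → (x ^ (j ℕ.+ suc l)) j ≈ 0#
  x^-coefficient zero    l = x-⊛-zero (x ^ l)
  x^-coefficient (suc j) l = trans (x-⊛-suc (x ^ (j ℕ.+ suc l)) j) (x^-coefficient j l)

  sgn : ℕ → Carrier
  sgn zero    = 1#
  sgn (suc n) = - sgn n

  alternate : Series → Series
  alternate f n = sgn n * f n

  alternate-cong : ∀ {f g} → f ≋ g → alternate f ≋ alternate g
  alternate-cong f≈g n = *-congˡ (f≈g n)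

  alternate-⊛ : ∀ f g → alternate (f ⊛ g) ≋ alternate f ⊛ alternate g
  alternate-⊛ f g zero = begin
    1# * (f 0 * g 0 + 0#)            ≈⟨ *-identityˡ _ ⟩
    f 0 * g 0 + 0#                   ≈⟨ +-congʳ (*-cong (*-identityˡ _) (*-identityˡ _)) ⟨
    1# * f 0 * (1# * g 0) + 0#       ∎
  alternate-⊛ f g (suc n) = begin
    - sgn n * (f 0 * g (suc n) + (tail f ⊛ g) n)
      ≈⟨ distribˡ _ _ _ ⟩
    - sgn n * (f 0 * g (suc n)) + - sgn n * (tail f ⊛ g) n
      ≈⟨ +-cong (trans (x*yz≈y*xz _ _ _) (*-congʳ (sym (*-identityˡ _)))) (begin
           - sgn n * (tail f ⊛ g) n                    ≈⟨ *-congʳ (trans (-‿cong (sym (*-identityˡ _))) (-‿distribˡ-* _ _)) ⟩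
           - 1# * sgn n * (tail f ⊛ g) n               ≈⟨ *-assoc _ _ _ ⟩
           - 1# * alternate (tail f ⊛ g) n             ≈⟨ *-congˡ (alternate-⊛ (tail f) g n) ⟩
           - 1# * (alternate (tail f) ⊛ alternate g) n ≈⟨ ·-⊛ (- 1#) (alternate (tail f)) (alternate g) n ⟨
           ((- 1# · alternate (tail f)) ⊛ alternate g) n ≈⟨ ⊛-congʳ (alternate g) tail-alternate n ⟩
           (tail (alternate f) ⊛ alternate g) n        ∎) ⟩
    1# * f 0 * (- sgn n * g (suc n)) + (tail (alternate f) ⊛ alternate g) n ∎
    where
    tail-alternate : (- 1# · alternate (tail f)) ≋ tail (alternate f)
    tail-alternate n = begin
      - 1# * (sgn n * f (suc n))   ≈⟨ *-assoc _ _ _ ⟨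
      - 1# * sgn n * f (suc n)     ≈⟨ *-congʳ (trans (sym (-‿distribˡ-* _ _)) (-‿cong (*-identityˡ _))) ⟩
      - sgn n * f (suc n)          ∎

module _ {a ℓa b ℓb} (A : CommutativeRing a ℓa) (B : CommutativeRing b ℓb)
         {h : CommutativeRing.Carrier A → CommutativeRing.Carrier B}
         (isHom : IsRingHomomorphism (CommutativeRing.rawRing A) (CommutativeRing.rawRing B) h) where
  private
    module A = PowerSeries A
    module B = PowerSeries B
  open CommutativeRing B hiding (zero)
  open IsRingHomomorphism isHom

  -- Needed for two homomorphisms: the constants ℚ → ℚ⟦x⟧, and ι : ℚ → 𝕂, which carries the
  -- identities for ε over to 𝕂.
  map-⊛ : ∀ f g → (λ n → h ((f A.⊛ g) n)) B.≋ (λ n → h (f n)) B.⊛ (λ n → h (g n))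
  map-⊛ f g zero    = trans (+-homo _ _) (+-cong (*-homo _ _) 0#-homo)
  map-⊛ f g (suc n) = trans (+-homo _ _) (+-cong (*-homo _ _) (map-⊛ (A.tail f) g n))

  map-constant : ∀ a → (λ n → h (constant (CommutativeRing.rawRing A) a n)) B.≋ constant rawRing (h a)
  map-constant a zero    = refl
  map-constant a (suc _) = 0#-homo

-- The generating function 2/(eᵗ+1)

module _ where
  open ≡ using (refl; sym; trans; cong; cong₂; module ≡-Reasoning)
  open PowerSeries ℚ.+-*-commutativeRing
  private
    module S = CommutativeRing powerSeriesRing
    module ℚ-Properties = RingProperties (CommutativeRing.ring ℚ.+-*-commutativeRing)

  -- Normalised fractions hide gcd computations. Through unnormalised fractions, identities between
  -- integer fractions reduce to cross multiplication.
  fromℚᵘ-homo-+ : ∀ p q → fromℚᵘ (p ℚᵘ.+ q) ≡ fromℚᵘ p ℚ.+ fromℚᵘ q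
  fromℚᵘ-homo-+ p q = ℚ.toℚᵘ-injective (begin
    toℚᵘ (fromℚᵘ (p ℚᵘ.+ q))               ≈⟨ ℚ.toℚᵘ-fromℚᵘ (p ℚᵘ.+ q) ⟩
    p ℚᵘ.+ q                               ≈⟨ ℚᵘ.+-cong (ℚ.toℚᵘ-fromℚᵘ p) (ℚ.toℚᵘ-fromℚᵘ q) ⟨
    toℚᵘ (fromℚᵘ p) ℚᵘ.+ toℚᵘ (fromℚᵘ q)   ≈⟨ ℚ.toℚᵘ-homo-+ (fromℚᵘ p) (fromℚᵘ q) ⟨
    toℚᵘ (fromℚᵘ p ℚ.+ fromℚᵘ q)           ∎)
    where open ≈-Reasoning ℚᵘ.≃-setoid

  fromℚᵘ-homo-* : ∀ p q → fromℚᵘ (p ℚᵘ.* q) ≡ fromℚᵘ p ℚ.* fromℚᵘ q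
  fromℚᵘ-homo-* p q = ℚ.toℚᵘ-injective (begin
    toℚᵘ (fromℚᵘ (p ℚᵘ.* q))               ≈⟨ ℚ.toℚᵘ-fromℚᵘ (p ℚᵘ.* q) ⟩
    p ℚᵘ.* q                               ≈⟨ ℚᵘ.*-cong (ℚ.toℚᵘ-fromℚᵘ p) (ℚ.toℚᵘ-fromℚᵘ q) ⟨
    toℚᵘ (fromℚᵘ p) ℚᵘ.* toℚᵘ (fromℚᵘ q)   ≈⟨ ℚ.toℚᵘ-homo-* (fromℚᵘ p) (fromℚᵘ q) ⟨
    toℚᵘ (fromℚᵘ p ℚ.* fromℚᵘ q)           ∎)
    where open ≈-Reasoning ℚᵘ.≃-setoid

  fromℤ : ℤ → ℚ
  fromℤ i = i / 1

  fromℤ-+ : ∀ i j → fromℤ (i ℤ.+ j) ≡ fromℤ i ℚ.+ fromℤ j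
  fromℤ-+ i j = trans
    (ℚ.fromℚᵘ-cong {mkℚᵘ (i ℤ.+ j) 0} {mkℚᵘ i 0 ℚᵘ.+ mkℚᵘ j 0}
      (*≡* (cong (ℤ._* + 1) (sym (cong₂ ℤ._+_ (ℤ.*-identityʳ i) (ℤ.*-identityʳ j))))))
    (fromℚᵘ-homo-+ (mkℚᵘ i 0) (mkℚᵘ j 0))

  fromℤ-* : ∀ i j → fromℤ (i ℤ.* j) ≡ fromℤ i ℚ.* fromℤ j
  fromℤ-* i j = fromℚᵘ-homo-* (mkℚᵘ i 0) (mkℚᵘ j 0)

  fromℤ-neg : ∀ i → fromℤ (ℤ.- i) ≡ ℚ.- fromℤ i
  fromℤ-neg (+ zero)  = refl
  fromℤ-neg (+ suc n) = refl
  fromℤ-neg -[1+ n ]  = sym (ℚ-Properties.-‿involutive (fromℤ (+ suc n)))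

  fromℤ-inverseʳ : ∀ n .{{_ : ℕ.NonZero n}} → fromℤ (+ n) ℚ.* (+ 1 / n) ≡ 1ℚ
  fromℤ-inverseʳ (suc n) = trans (sym (fromℚᵘ-homo-* (mkℚᵘ (+ suc n) 0) (mkℚᵘ (+ 1) n)))
    (ℚ.fromℚᵘ-cong {mkℚᵘ (+ suc n) 0 ℚᵘ.* mkℚᵘ (+ 1) n} {mkℚᵘ (+ 1) 0}
      (*≡* (cong +_ (trans (cong (ℕ._* 1) (ℕ.*-identityʳ (suc n))) (trans (ℕ.*-identityʳ _) (sym (trans (ℕ.*-identityˡ _) (ℕ.*-identityˡ _))))))))

  exp : Series
  exp n = 1/ n !

  !-exp : ∀ n → fromℤ (+ (n !)) ℚ.* exp n ≡ 1ℚ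
  !-exp n = fromℤ-inverseʳ (n !) {{n ℕ.!≢0}}

  exp-suc : ∀ n → fromℤ (+ suc n) ℚ.* exp (suc n) ≡ exp n
  exp-suc n = begin
    s ℚ.* e′                      ≡⟨ ℚ.*-identityˡ _ ⟨
    1ℚ ℚ.* (s ℚ.* e′)             ≡⟨ cong (ℚ._* (s ℚ.* e′)) (!-exp n) ⟨
    F ℚ.* exp n ℚ.* (s ℚ.* e′)    ≡⟨ solve 4 (λ F e s e′ → F :* e :* (s :* e′) := e :* (s :* F :* e′)) refl F (exp n) s e′ ⟩
    exp n ℚ.* (s ℚ.* F ℚ.* e′)    ≡⟨ cong (λ z → exp n ℚ.* (z ℚ.* e′)) (trans (sym (fromℤ-* (+ suc n) (+ (n !)))) (cong fromℤ (sym (ℤ.pos-* (suc n) (n !))))) ⟩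
    exp n ℚ.* (fromℤ (+ (suc n !)) ℚ.* e′) ≡⟨ cong (exp n ℚ.*_) (!-exp (suc n)) ⟩
    exp n ℚ.* 1ℚ                  ≡⟨ ℚ.*-identityʳ _ ⟩
    exp n                         ∎
    where
    open ≡-Reasoning
    open ℚ-Solver.+-*-Solver
    s e′ F : ℚ
    s = fromℤ (+ suc n)
    e′ = exp (suc n)
    F = fromℤ (+ (n !))

  -- The Euler derivation t·d/dt. Unlike d/dt it preserves degrees, so its Leibniz rule and the
  -- equation Θ eᵗ = t eᵗ need no shift of indices.
  Θ : Series → Series
  Θ f n = fromℤ (+ n) ℚ.* f n

  Θ-⊛ : ∀ f g → Θ (f ⊛ g) ≋ (Θ f ⊛ g) ⊕ (f ⊛ Θ g)
  Θ-⊛ f g zero = solve 2 (λ a b → con 0ℚ :* (a :* b :+ con 0ℚ) := con 0ℚ :* a :* b :+ con 0ℚ :+ (a :* (con 0ℚ :* b) :+ con 0ℚ)) refl (f 0) (g 0)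
    where open ℚ-Solver.+-*-Solver
  Θ-⊛ f g (suc n) = begin
    N′ ℚ.* (f 0 ℚ.* g (suc n) ℚ.+ (tail f ⊛ g) n)
      ≡⟨ cong (λ z → z ℚ.* (f 0 ℚ.* g (suc n) ℚ.+ (tail f ⊛ g) n)) (fromℤ-+ (+ 1) (+ n)) ⟩
    (1ℚ ℚ.+ N) ℚ.* (f 0 ℚ.* g (suc n) ℚ.+ (tail f ⊛ g) n)
      ≡⟨ solve 4 (λ N a b c → (con 1ℚ :+ N) :* (a :* b :+ c) := a :* ((con 1ℚ :+ N) :* b) :+ (c :+ N :* c)) refl N (f 0) (g (suc n)) ((tail f ⊛ g) n) ⟩
    f 0 ℚ.* ((1ℚ ℚ.+ N) ℚ.* g (suc n)) ℚ.+ ((tail f ⊛ g) n ℚ.+ Θ (tail f ⊛ g) n)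
      ≡⟨ cong₂ (λ y z → f 0 ℚ.* (y ℚ.* g (suc n)) ℚ.+ ((tail f ⊛ g) n ℚ.+ z)) (sym (fromℤ-+ (+ 1) (+ n))) (Θ-⊛ (tail f) g n) ⟩
    f 0 ℚ.* Θ g (suc n) ℚ.+ ((tail f ⊛ g) n ℚ.+ ((Θ (tail f) ⊛ g) n ℚ.+ (tail f ⊛ Θ g) n))
      -- The null term is inserted because it heads the expansion of `(Θ f ⊛ g) (suc n)`: the
      -- constant term of `Θ f` is `0ℚ ℚ.* f 0`.
      ≡⟨ solve 5 (λ a b c d h → a :+ (b :+ (c :+ d)) := con 0ℚ :* h :+ (b :+ c) :+ (a :+ d)) refl
           (f 0 ℚ.* Θ g (suc n)) ((tail f ⊛ g) n) ((Θ (tail f) ⊛ g) n) ((tail f ⊛ Θ g) n) (f 0 ℚ.* g (suc n)) ⟩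
    0ℚ ℚ.* (f 0 ℚ.* g (suc n)) ℚ.+ ((tail f ⊛ g) n ℚ.+ (Θ (tail f) ⊛ g) n) ℚ.+ (f ⊛ Θ g) (suc n)
      ≡⟨ cong (ℚ._+ (f ⊛ Θ g) (suc n)) (cong₂ ℚ._+_ (sym (ℚ.*-assoc 0ℚ (f 0) (g (suc n)))) (sym (⊛-distribʳ g (tail f) (Θ (tail f)) n))) ⟩
    0ℚ ℚ.* f 0 ℚ.* g (suc n) ℚ.+ ((tail f ⊕ Θ (tail f)) ⊛ g) n ℚ.+ (f ⊛ Θ g) (suc n)
      ≡⟨ cong (λ z → 0ℚ ℚ.* f 0 ℚ.* g (suc n) ℚ.+ z ℚ.+ (f ⊛ Θ g) (suc n)) (⊛-congʳ g tail-Θ n) ⟩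
    (Θ f ⊛ g) (suc n) ℚ.+ (f ⊛ Θ g) (suc n) ∎
    where
    open ≡-Reasoning
    open ℚ-Solver.+-*-Solver
    N N′ : ℚ
    N = fromℤ (+ n)
    N′ = fromℤ (+ suc n)
    tail-Θ : tail f ⊕ Θ (tail f) ≋ tail (Θ f)
    tail-Θ m = trans
      (solve 2 (λ a b → b :+ a :* b := (con 1ℚ :+ a) :* b) refl (fromℤ (+ m)) (f (suc m)))
      (cong (ℚ._* f (suc m)) (sym (fromℤ-+ (+ 1) (+ m))))

  Θ-exp : Θ exp ≋ x ⊛ exp
  Θ-exp zero    = refl
  Θ-exp (suc n) = trans (exp-suc n) (sym (x-⊛-suc exp n))

  Θ-alternate-exp : Θ (alternate exp) ≋ ⊖ (x ⊛ alternate exp)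
  Θ-alternate-exp zero    = refl
  Θ-alternate-exp (suc n) = begin
    s ℚ.* (ℚ.- sgn n ℚ.* e′)       ≡⟨ solve 3 (λ s g e → s :* (:- g :* e) := :- (g :* (s :* e))) refl s (sgn n) e′ ⟩
    ℚ.- (sgn n ℚ.* (s ℚ.* e′))     ≡⟨ cong (λ z → ℚ.- (sgn n ℚ.* z)) (exp-suc n) ⟩
    ℚ.- alternate exp n            ≡⟨ cong ℚ.-_ (x-⊛-suc (alternate exp) n) ⟨
    ℚ.- (x ⊛ alternate exp) (suc n) ∎
    where
    open ≡-Reasoning
    open ℚ-Solver.+-*-Solver
    s e′ : ℚ
    s = fromℤ (+ suc n)
    e′ = exp (suc n)

  Θ≋𝟘⇒tail≋𝟘 : ∀ {f} → Θ f ≋ 𝟘 → ∀ n → f (suc n) ≡ 0ℚ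
  Θ≋𝟘⇒tail≋𝟘 {f} Θf≈0 n = begin
    f (suc n)                     ≡⟨ ℚ.*-identityˡ _ ⟨
    1ℚ ℚ.* f (suc n)              ≡⟨ cong (ℚ._* f (suc n)) (fromℤ-inverseʳ (suc n)) ⟨
    s ℚ.* t ℚ.* f (suc n)         ≡⟨ solve 3 (λ s t f → s :* t :* f := t :* (s :* f)) refl s t (f (suc n)) ⟩
    t ℚ.* (s ℚ.* f (suc n))       ≡⟨ cong (t ℚ.*_) (Θf≈0 (suc n)) ⟩
    t ℚ.* 0ℚ                      ≡⟨ ℚ.*-zeroʳ t ⟩
    0ℚ                            ∎
    where
    open ≡-Reasoning
    open ℚ-Solver.+-*-Solver
    s t : ℚ
    s = fromℤ (+ suc n)
    t = + 1 / suc n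

  -- Θ annihilates eᵗe⁻ᵗ, and over ℚ this leaves only the constant term. The binomial theorem is
  -- thereby avoided.
  exp-alternate-exp : exp ⊛ alternate exp ≋ 𝟙
  exp-alternate-exp zero    = refl
  exp-alternate-exp (suc n) = Θ≋𝟘⇒tail≋𝟘 Θ≋𝟘 n
    where
    open ≈-Reasoning S.setoid
    open RingProperties S.ring using (-‿distribʳ-*)
    Θ≋𝟘 : Θ (exp ⊛ alternate exp) ≋ 𝟘
    Θ≋𝟘 = begin
      Θ (exp ⊛ alternate exp)                                         ≈⟨ Θ-⊛ exp (alternate exp) ⟩
      (Θ exp ⊛ alternate exp) ⊕ (exp ⊛ Θ (alternate exp))             ≈⟨ S.+-cong (⊛-congʳ (alternate exp) Θ-exp) (⊛-congˡ exp Θ-alternate-exp) ⟩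
      ((x ⊛ exp) ⊛ alternate exp) ⊕ (exp ⊛ (⊖ (x ⊛ alternate exp)))   ≈⟨ S.+-cong (⊛-congʳ (alternate exp) (⊛-comm x exp)) (S.sym (-‿distribʳ-* exp (x ⊛ alternate exp))) ⟩
      ((exp ⊛ x) ⊛ alternate exp) ⊕ (⊖ (exp ⊛ (x ⊛ alternate exp)))   ≈⟨ S.+-congʳ (⊛-assoc exp x (alternate exp)) ⟩
      (exp ⊛ (x ⊛ alternate exp)) ⊕ (⊖ (exp ⊛ (x ⊛ alternate exp)))   ≈⟨ S.-‿inverseʳ (exp ⊛ (x ⊛ alternate exp)) ⟩
      𝟘                                                               ∎

  -- 2/(eᵗ+1), whose coefficients are Eₙ(0)/n!
  ε : Series
  ε = divide ℚ.+-*-rawRing ½ (𝟙 ⊕ 𝟙) (exp ⊕ 𝟙)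

  ε-⊛ : ε ⊛ (exp ⊕ 𝟙) ≋ 𝟙 ⊕ 𝟙
  ε-⊛ = divide-⊛ ½ (𝟙 ⊕ 𝟙) (exp ⊕ 𝟙) refl

  ε⁻¹ : Series
  ε⁻¹ = ½ · (exp ⊕ 𝟙)

  ε⁻¹-⊛ : ε⁻¹ ⊛ ε ≋ 𝟙
  ε⁻¹-⊛ n = trans (·-⊛ ½ (exp ⊕ 𝟙) ε n) (trans (cong (½ ℚ.*_) (trans (⊛-comm (exp ⊕ 𝟙) ε n) (ε-⊛ n))) (half n))
    where
    half : ½ · (𝟙 ⊕ 𝟙) ≋ 𝟙
    half zero    = refl
    half (suc _) = refl

  alternate-⊕𝟙 : ∀ f → alternate (f ⊕ 𝟙) ≋ alternate f ⊕ 𝟙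
  alternate-⊕𝟙 f zero    = ℚ.*-distribˡ-+ 1ℚ (f 0) 1ℚ
  alternate-⊕𝟙 f (suc n) = trans (ℚ.*-distribˡ-+ (sgn (suc n)) (f (suc n)) 0ℚ) (cong (alternate f (suc n) ℚ.+_) (ℚ.*-zeroʳ (sgn (suc n))))

  alternate-𝟙⊕𝟙 : alternate (𝟙 ⊕ 𝟙) ≋ 𝟙 ⊕ 𝟙
  alternate-𝟙⊕𝟙 zero    = refl
  alternate-𝟙⊕𝟙 (suc n) = ℚ.*-zeroʳ (sgn (suc n))

  -- Both sides become 2eᵗ after multiplication by the invertible eᵗ+1; on the left this uses eᵗ+1 =
  -- (e⁻ᵗ+1)eᵗ and the multiplicativity of t ↦ -t.
  alternate-ε : alternate ε ≋ ε ⊛ exp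
  alternate-ε = ⊛-cancelʳ-invertible {h = exp ⊕ 𝟙} {v = ½ · ε} invertible (begin
      alternate ε ⊛ (exp ⊕ 𝟙)                        ≈⟨ ⊛-congˡ (alternate ε) exp⊕𝟙 ⟩
      alternate ε ⊛ (alternate (exp ⊕ 𝟙) ⊛ exp)      ≈⟨ ⊛-assoc (alternate ε) (alternate (exp ⊕ 𝟙)) exp ⟨
      (alternate ε ⊛ alternate (exp ⊕ 𝟙)) ⊛ exp      ≈⟨ ⊛-congʳ exp (alternate-⊛ ε (exp ⊕ 𝟙)) ⟨
      alternate (ε ⊛ (exp ⊕ 𝟙)) ⊛ exp                ≈⟨ ⊛-congʳ exp (alternate-cong ε-⊛) ⟩
      alternate (𝟙 ⊕ 𝟙) ⊛ exp                        ≈⟨ ⊛-congʳ exp alternate-𝟙⊕𝟙 ⟩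
      (𝟙 ⊕ 𝟙) ⊛ exp                                  ≈⟨ ⊛-congʳ exp ε-⊛ ⟨
      (ε ⊛ (exp ⊕ 𝟙)) ⊛ exp                          ≈⟨ ⊛-assoc ε (exp ⊕ 𝟙) exp ⟩
      ε ⊛ ((exp ⊕ 𝟙) ⊛ exp)                          ≈⟨ ⊛-congˡ ε (⊛-comm (exp ⊕ 𝟙) exp) ⟩
      ε ⊛ (exp ⊛ (exp ⊕ 𝟙))                          ≈⟨ ⊛-assoc ε exp (exp ⊕ 𝟙) ⟨
      (ε ⊛ exp) ⊛ (exp ⊕ 𝟙)                          ∎)
    where
    open ≈-Reasoning S.setoid
    invertible : (exp ⊕ 𝟙) ⊛ (½ · ε) ≋ 𝟙
    invertible n = trans (⊛-comm (exp ⊕ 𝟙) (½ · ε) n) (trans (·-⊛ ½ ε (exp ⊕ 𝟙) n)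
      (trans (cong (½ ℚ.*_) (⊛-comm ε (exp ⊕ 𝟙) n)) (trans (sym (·-⊛ ½ (exp ⊕ 𝟙) ε n)) (ε⁻¹-⊛ n))))
    exp⊕𝟙 : exp ⊕ 𝟙 ≋ alternate (exp ⊕ 𝟙) ⊛ exp
    exp⊕𝟙 = begin
      exp ⊕ 𝟙                                ≈⟨ S.+-cong (𝟙-⊛ exp) (S.trans (⊛-comm (alternate exp) exp) exp-alternate-exp) ⟨
      (𝟙 ⊛ exp) ⊕ (alternate exp ⊛ exp)      ≈⟨ S.+-comm (𝟙 ⊛ exp) (alternate exp ⊛ exp) ⟩
      (alternate exp ⊛ exp) ⊕ (𝟙 ⊛ exp)      ≈⟨ ⊛-distribʳ exp (alternate exp) 𝟙 ⟨
      (alternate exp ⊕ 𝟙) ⊛ exp              ≈⟨ ⊛-congʳ exp (alternate-⊕𝟙 exp) ⟨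
      alternate (exp ⊕ 𝟙) ⊛ exp              ∎

  sgn-even : ∀ n → sgn (2 ℕ.* n) ≡ 1ℚ
  sgn-even zero    = refl
  sgn-even (suc n) = trans (cong sgn (cong suc (ℕ.+-suc n (n ℕ.+ 0)))) (trans (ℚ-Properties.-‿involutive _) (sgn-even n))

  -- In even degree ε(-t) and ε(t) have the same coefficient, so twice that of ε is the coefficient
  -- of ε(eᵗ+1) = 2, which vanishes in positive degree.
  ε-even : ∀ n → ε (2 ℕ.* suc n) ≡ 0ℚ
  ε-even n = begin
    ε m                                   ≡⟨ solve 1 (λ a → a := con ½ :* (con 1ℚ :* a :+ a)) refl (ε m) ⟩
    ½ ℚ.* (1ℚ ℚ.* ε m ℚ.+ ε m)            ≡⟨ cong (λ z → ½ ℚ.* (z ℚ.* ε m ℚ.+ ε m)) (sgn-even (suc n)) ⟨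
    ½ ℚ.* (alternate ε m ℚ.+ ε m)         ≡⟨ cong₂ (λ y z → ½ ℚ.* (y ℚ.+ z)) (alternate-ε m) (sym (S.*-identityʳ ε m)) ⟩
    ½ ℚ.* ((ε ⊛ exp) m ℚ.+ (ε ⊛ 𝟙) m)     ≡⟨ cong (½ ℚ.*_) (S.distribˡ ε exp 𝟙 m) ⟨
    ½ ℚ.* (ε ⊛ (exp ⊕ 𝟙)) m               ≡⟨ cong (½ ℚ.*_) (ε-⊛ m) ⟩
    0ℚ                                    ∎
    where
    open ≡-Reasoning
    open ℚ-Solver.+-*-Solver
    m : ℕ
    m = 2 ℕ.* suc n

-- Coefficients of the Euler polynomials

module _ where
  open ≡ using (refl; sym; trans; cong; cong₂; module ≡-Reasoning)

  private
    module Qx = PowerSeries ℚ.+-*-commutativeRing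
    module Qxt = PowerSeries Qx.powerSeriesRing
    module Sx = CommutativeRing Qx.powerSeriesRing
    module Sxt = CommutativeRing Qxt.powerSeriesRing
    open Qxt using (_⊛_; _≋_; _⊕_; 𝟙)

  constants : Qx.Series → Qxt.Series
  constants f n = ℚ⟦x⟧.const (f n)

  constants-𝟙 : constants Qx.𝟙 ≋ 𝟙
  constants-𝟙 zero    _       = refl
  constants-𝟙 (suc n) zero    = refl
  constants-𝟙 (suc n) (suc _) = refl

  private
    module C = IsRingHomomorphism Qx.constant-isRingHomomorphism

  constants-⊕𝟙 : ∀ f → constants (f Qx.⊕ Qx.𝟙) ≋ constants f ⊕ 𝟙
  constants-⊕𝟙 f n = Sx.trans (C.+-homo (f n) (Qx.𝟙 n)) (Sx.+-congˡ {x = ℚ⟦x⟧.const (f n)} (constants-𝟙 n))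

  exp[𝟙t] : exp[ ℚ⟦x⟧.1# t] ⊕ 𝟙 ≋ constants (exp Qx.⊕ Qx.𝟙)
  exp[𝟙t] = Sxt.trans
    (Sxt.+-congʳ {x = 𝟙} (λ n → Sx.trans (Qx.⊛-congˡ (ℚ⟦x⟧.const (exp n)) (Qx.𝟙^ n))
      (Sx.*-identityʳ (ℚ⟦x⟧.const (exp n)))))
    (Sxt.sym (constants-⊕𝟙 exp))

  -- `eulerGF` is a quotient formed over ℚ⟦x⟧ and ε one formed over ℚ. Uniqueness of division allows
  -- the factor eˣᵗ to be split off.
  eulerGF-factorization : eulerGF ≋ constants ε ⊛ exp[ ℚ⟦x⟧.x t]
  eulerGF-factorization = Qxt.divide-unique (ℚ⟦x⟧.const ½) ((𝟙 ⊕ 𝟙) ⊛ eˣᵗ) (exp[ ℚ⟦x⟧.1# t] ⊕ 𝟙) (constants ε ⊛ eˣᵗ)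
    unit
    (begin
      (constants ε ⊛ eˣᵗ) ⊛ (exp[ ℚ⟦x⟧.1# t] ⊕ 𝟙)       ≈⟨ Qxt.⊛-congˡ (constants ε ⊛ eˣᵗ) exp[𝟙t] ⟩
      (constants ε ⊛ eˣᵗ) ⊛ G                           ≈⟨ Qxt.⊛-assoc (constants ε) eˣᵗ G ⟩
      constants ε ⊛ (eˣᵗ ⊛ G)                           ≈⟨ Qxt.⊛-congˡ (constants ε) (Qxt.⊛-comm eˣᵗ G) ⟩
      constants ε ⊛ (G ⊛ eˣᵗ)                           ≈⟨ Qxt.⊛-assoc (constants ε) G eˣᵗ ⟨
      (constants ε ⊛ G) ⊛ eˣᵗ                           ≈⟨ Qxt.⊛-congʳ eˣᵗ two ⟩
      (𝟙 ⊕ 𝟙) ⊛ eˣᵗ                                     ∎)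
    where
    open ≈-Reasoning Sxt.setoid
    eˣᵗ G : Qxt.Series
    eˣᵗ = exp[ ℚ⟦x⟧.x t]
    G = constants (exp Qx.⊕ Qx.𝟙)
    unit : ℚ⟦x⟧.const ½ Qx.⊛ ((exp[ ℚ⟦x⟧.1# t] ⊕ 𝟙) 0) Qx.≋ Qx.𝟙
    unit = Sx.trans (Qx.⊛-congˡ (ℚ⟦x⟧.const ½) (exp[𝟙t] 0))
      (Sx.sym (C.*-homo ½ (1ℚ ℚ.+ 1ℚ)))
    two : constants ε ⊛ G ≋ 𝟙 ⊕ 𝟙
    two = begin
      constants ε ⊛ G                      ≈⟨ map-⊛ ℚ.+-*-commutativeRing Qx.powerSeriesRing Qx.constant-isRingHomomorphism ε (exp Qx.⊕ Qx.𝟙) ⟨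
      constants (ε Qx.⊛ (exp Qx.⊕ Qx.𝟙))   ≈⟨ (λ n → C.⟦⟧-cong (ε-⊛ n)) ⟩
      constants (Qx.𝟙 Qx.⊕ Qx.𝟙)           ≈⟨ constants-⊕𝟙 Qx.𝟙 ⟩
      constants Qx.𝟙 ⊕ 𝟙                   ≈⟨ Sxt.+-congʳ {x = 𝟙} constants-𝟙 ⟩
      𝟙 ⊕ 𝟙                                ∎

  private
    -- c(x t)
    dilate : Qx.Series → Qxt.Series
    dilate c n = ℚ⟦x⟧.const (c n) ℚ⟦x⟧.* (ℚ⟦x⟧.x ℚ⟦x⟧.^ n)

    tail-dilate : ∀ c → Qxt.tail (dilate c) ≋ ℚ⟦x⟧.x Qxt.· dilate (Qx.tail c)
    tail-dilate c n = begin
      k Qx.⊛ (Qx.x Qx.⊛ xⁿ)     ≈⟨ Qx.⊛-assoc k Qx.x xⁿ ⟨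
      (k Qx.⊛ Qx.x) Qx.⊛ xⁿ     ≈⟨ Qx.⊛-congʳ xⁿ (Qx.⊛-comm k Qx.x) ⟩
      (Qx.x Qx.⊛ k) Qx.⊛ xⁿ     ≈⟨ Qx.⊛-assoc Qx.x k xⁿ ⟩
      Qx.x Qx.⊛ (k Qx.⊛ xⁿ)     ∎
      where
      open ≈-Reasoning Sx.setoid
      k xⁿ : Qx.Series
      k = ℚ⟦x⟧.const (c (suc n))
      xⁿ = ℚ⟦x⟧.x ℚ⟦x⟧.^ n

    dilate-⊛-zero : ∀ c f l → dilate c 0 Qx.⊛ constants f l Qx.≋ ℚ⟦x⟧.const (c 0 ℚ.* f l)
    dilate-⊛-zero c f l = Sx.trans (Qx.⊛-congʳ (constants f l) (Sx.*-identityʳ (ℚ⟦x⟧.const (c 0))))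
      (Sx.sym (C.*-homo (c 0) (f l)))

    dilate-⊛-suc : ∀ c f n → (dilate c ⊛ constants f) (suc n) Qx.≋
      ℚ⟦x⟧.const (c 0 ℚ.* f (suc n)) Qx.⊕ (Qx.x Qx.⊛ (dilate (Qx.tail c) ⊛ constants f) n)
    dilate-⊛-suc c f n = Sx.+-cong (dilate-⊛-zero c f (suc n))
      (Sx.trans (Qxt.⊛-congʳ (constants f) (tail-dilate c) n) (Qxt.·-⊛ ℚ⟦x⟧.x (dilate (Qx.tail c)) (constants f) n))

    -- In c(xt) the exponents of x and t agree, so xʲ fixes the contribution tʲ of this factor and
    -- leaves tˡ to f.
    dilate-⊛-coefficient : ∀ c f j l → (dilate c ⊛ constants f) (j ℕ.+ l) j ≡ c j ℚ.* f l
    dilate-⊛-coefficient c f zero zero =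
      trans (ℚ.+-identityʳ ((dilate c 0 Qx.⊛ constants f 0) 0)) (dilate-⊛-zero c f 0 0)
    dilate-⊛-coefficient c f zero (suc l) = trans (dilate-⊛-suc c f l 0)
      (trans (cong (c 0 ℚ.* f (suc l) ℚ.+_) (Qx.x-⊛-zero ((dilate (Qx.tail c) ⊛ constants f) l))) (ℚ.+-identityʳ (c 0 ℚ.* f (suc l))))
    dilate-⊛-coefficient c f (suc j) l = trans (dilate-⊛-suc c f (j ℕ.+ l) (suc j))
      (trans (ℚ.+-identityˡ ((Qx.x Qx.⊛ (dilate (Qx.tail c) ⊛ constants f) (j ℕ.+ l)) (suc j)))
      (trans (Qx.x-⊛-suc ((dilate (Qx.tail c) ⊛ constants f) (j ℕ.+ l)) j) (dilate-⊛-coefficient (Qx.tail c) f j l)))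

  -- Writing the degree as `j ℕ.+ suc l` encodes that j is below it, so that the leading power xⁿ
  -- does not contribute.
  x^-E-coefficient : ∀ j l → (x^ j ℕ.+ suc l -E) j ≡ ℚ.- (fromℤ (+ ((j ℕ.+ suc l) !)) ℚ.* (exp j ℚ.* ε (suc l)))
  x^-E-coefficient j l = trans (cong₂ ℚ._+_ (Qx.x^-coefficient j l) (cong ℚ.-_ (begin
      E n j                                                 ≡⟨ Qx.constant-⊛ (fromℤ (+ (n !))) (eulerGF n) j ⟩
      fromℤ (+ (n !)) ℚ.* eulerGF n j                       ≡⟨ cong (fromℤ (+ (n !)) ℚ.*_) (eulerGF-factorization n j) ⟩
      fromℤ (+ (n !)) ℚ.* (constants ε ⊛ dilate exp) n j    ≡⟨ cong (fromℤ (+ (n !)) ℚ.*_) (Qxt.⊛-comm (constants ε) (dilate exp) n j) ⟩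
      fromℤ (+ (n !)) ℚ.* (dilate exp ⊛ constants ε) n j    ≡⟨ cong (fromℤ (+ (n !)) ℚ.*_) (dilate-⊛-coefficient exp ε j (suc l)) ⟩
      fromℤ (+ (n !)) ℚ.* (exp j ℚ.* ε (suc l))             ∎)))
    (ℚ.+-identityˡ _)
    where
    open ≡-Reasoning
    n : ℕ
    n = j ℕ.+ suc l

-- Index shifts and parity

suc-+ : ∀ q i → ℤ.suc q ℤ.+ + i ≡ q ℤ.+ + suc i
suc-+ q i = ≡.trans (≡.cong (ℤ._+ + i) (ℤ.+-comm (+ 1) q)) (ℤ.+-assoc q (+ 1) (+ i))

-- In contrast to `2 ℕ.* n` this exposes two successors at once, as required by inductions that take
-- two steps of the recursion of `M`.
double : ℕ → ℕ
double zero    = zero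
double (suc n) = suc (suc (double n))

double≡2* : ∀ n → double n ≡ 2 ℕ.* n
double≡2* zero    = ≡.refl
double≡2* (suc n) = ≡.cong suc (≡.trans (≡.cong suc (double≡2* n)) (≡.sym (ℕ.+-suc n (n ℕ.+ 0))))

data Parity : ℕ → Set where
  even : ∀ n → Parity (double n)
  odd  : ∀ n → Parity (suc (double n))

parity : ∀ n → Parity n
parity zero    = even zero
parity (suc n) with parity n
... | even m = odd m
... | odd m  = even (suc m)

-- Rising factorials and the numbers κ

module _ where
  open ≡ using (refl; sym; trans; cong; cong₂; module ≡-Reasoning)
  open PowerSeries ℚ.+-*-commutativeRing using (sgn)

  poch : ℤ → ℕ → ℚ
  poch q zero    = 1ℚ
  poch q (suc l) = fromℤ q ℚ.* poch (ℤ.suc q) l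

  poch-last : ∀ q l → poch q (suc l) ≡ poch q l ℚ.* fromℤ (q ℤ.+ + l)
  poch-last q zero    = trans (ℚ.*-comm (fromℤ q) 1ℚ) (cong (λ z → 1ℚ ℚ.* fromℤ z) (sym (ℤ.+-identityʳ q)))
  poch-last q (suc l) = begin
    fromℤ q ℚ.* poch (ℤ.suc q) (suc l)                              ≡⟨ cong (fromℤ q ℚ.*_) (poch-last (ℤ.suc q) l) ⟩
    fromℤ q ℚ.* (poch (ℤ.suc q) l ℚ.* fromℤ (ℤ.suc q ℤ.+ + l))      ≡⟨ ℚ.*-assoc (fromℤ q) (poch (ℤ.suc q) l) (fromℤ (ℤ.suc q ℤ.+ + l)) ⟨
    poch q (suc l) ℚ.* fromℤ (ℤ.suc q ℤ.+ + l)                      ≡⟨ cong (λ z → poch q (suc l) ℚ.* fromℤ z) (suc-+ q l) ⟩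
    poch q (suc l) ℚ.* fromℤ (q ℤ.+ + suc l)                        ∎
    where open ≡-Reasoning

  poch-0 : ∀ l → poch (+ 0) (suc l) ≡ 0ℚ
  poch-0 l = ℚ.*-zeroˡ (poch (+ 1) l)

  -- Pascal's rule for the coefficients of (1 - x)^(-q).
  poch-pascal : ∀ q l → poch (ℤ.suc q) (suc l) ℚ.* exp (suc l) ℚ.+ ℚ.- (poch (ℤ.suc q) l ℚ.* exp l)
                      ≡ poch q (suc l) ℚ.* exp (suc l)
  poch-pascal q l = begin
    poch (ℤ.suc q) (suc l) ℚ.* e ℚ.+ ℚ.- (P ℚ.* exp l)
      ≡⟨ cong₂ (λ y z → y ℚ.* e ℚ.+ ℚ.- (P ℚ.* z)) (poch-last (ℤ.suc q) l) (sym (exp-suc l)) ⟩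
    P ℚ.* fromℤ (ℤ.suc q ℤ.+ + l) ℚ.* e ℚ.+ ℚ.- (P ℚ.* (L ℚ.* e))
      ≡⟨ cong (λ z → P ℚ.* z ℚ.* e ℚ.+ ℚ.- (P ℚ.* (L ℚ.* e))) (trans (cong fromℤ (suc-+ q l)) (fromℤ-+ q (+ suc l))) ⟩
    P ℚ.* (fromℤ q ℚ.+ L) ℚ.* e ℚ.+ ℚ.- (P ℚ.* (L ℚ.* e))
      ≡⟨ solve 4 (λ P q L e → P :* (q :+ L) :* e :+ :- (P :* (L :* e)) := q :* P :* e) refl P (fromℤ q) L e ⟩
    fromℤ q ℚ.* P ℚ.* e ∎
    where
    open ≡-Reasoning
    open ℚ-Solver.+-*-Solver
    P L e : ℚ
    P = poch (ℤ.suc q) l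
    L = fromℤ (+ suc l)
    e = exp (suc l)

  fromℤ-suc! : ∀ n → fromℤ (+ (suc n !)) ≡ fromℤ (+ suc n) ℚ.* fromℤ (+ (n !))
  fromℤ-suc! n = trans (cong fromℤ (ℤ.pos-* (suc n) (n !))) (fromℤ-* (+ suc n) (+ (n !)))

  -- The factors are j+1, ..., j+l. The quotient of factorials is stated as a product, which keeps
  -- division out of the induction.
  poch-positive : ∀ j l → poch (+ suc j) l ℚ.* fromℤ (+ (j !)) ≡ fromℤ (+ ((j ℕ.+ l) !))
  poch-positive j zero    = trans (ℚ.*-identityˡ _) (cong (λ z → fromℤ (+ (z !))) (sym (ℕ.+-identityʳ j)))
  poch-positive j (suc l) = begin
    fromℤ (+ suc j) ℚ.* poch (+ suc (suc j)) l ℚ.* fromℤ (+ (j !))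
      ≡⟨ solve 3 (λ a b c → a :* b :* c := b :* (a :* c)) refl (fromℤ (+ suc j)) (poch (+ suc (suc j)) l) (fromℤ (+ (j !))) ⟩
    poch (+ suc (suc j)) l ℚ.* (fromℤ (+ suc j) ℚ.* fromℤ (+ (j !)))
      ≡⟨ cong (poch (+ suc (suc j)) l ℚ.*_) (fromℤ-suc! j) ⟨
    poch (+ suc (suc j)) l ℚ.* fromℤ (+ (suc j !))
      ≡⟨ poch-positive (suc j) l ⟩
    fromℤ (+ ((suc j ℕ.+ l) !))
      ≡⟨ cong (λ z → fromℤ (+ (z !))) (ℕ.+-suc j l) ⟨
    fromℤ (+ ((j ℕ.+ suc l) !)) ∎
    where
    open ≡-Reasoning
    open ℚ-Solver.+-*-Solver

  suc-neg : ∀ m → ℤ.suc (ℤ.- + suc m) ≡ ℤ.- + m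
  suc-neg zero    = refl
  suc-neg (suc m) = refl

  -- The factors are -(j+l), ..., -(j+1): those of `poch-positive` in reverse order, each with a
  -- sign.
  poch-negative : ∀ j l → poch (ℤ.- + (j ℕ.+ l)) l ℚ.* fromℤ (+ (j !)) ≡ sgn l ℚ.* fromℤ (+ ((j ℕ.+ l) !))
  poch-negative j zero    = cong (λ z → 1ℚ ℚ.* fromℤ (+ (z !))) (sym (ℕ.+-identityʳ j))
  poch-negative j (suc l) rewrite ℕ.+-suc j l = begin
    fromℤ (ℤ.- + suc m) ℚ.* poch (ℤ.suc (ℤ.- + suc m)) l ℚ.* fromℤ (+ (j !))
      ≡⟨ cong₂ (λ y z → y ℚ.* poch z l ℚ.* fromℤ (+ (j !))) (fromℤ-neg (+ suc m)) (suc-neg m) ⟩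
    ℚ.- fromℤ (+ suc m) ℚ.* poch (ℤ.- + m) l ℚ.* fromℤ (+ (j !))
      ≡⟨ ℚ.*-assoc (ℚ.- fromℤ (+ suc m)) (poch (ℤ.- + m) l) (fromℤ (+ (j !))) ⟩
    ℚ.- fromℤ (+ suc m) ℚ.* (poch (ℤ.- + m) l ℚ.* fromℤ (+ (j !)))
      ≡⟨ cong (ℚ.- fromℤ (+ suc m) ℚ.*_) (poch-negative j l) ⟩
    ℚ.- fromℤ (+ suc m) ℚ.* (sgn l ℚ.* fromℤ (+ (m !)))
      ≡⟨ solve 3 (λ a b c → :- a :* (b :* c) := :- b :* (a :* c)) refl (fromℤ (+ suc m)) (sgn l) (fromℤ (+ (m !))) ⟩
    ℚ.- sgn l ℚ.* (fromℤ (+ suc m) ℚ.* fromℤ (+ (m !)))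
      ≡⟨ cong (ℚ.- sgn l ℚ.*_) (fromℤ-suc! m) ⟨
    ℚ.- sgn l ℚ.* fromℤ (+ (suc m !)) ∎
    where
    open ≡-Reasoning
    open ℚ-Solver.+-*-Solver
    m : ℕ
    m = j ℕ.+ l

  -- The factors run from -a up to l and pass through 0.
  poch-vanishing : ∀ a l → poch (ℤ.- + a) (suc (a ℕ.+ l)) ≡ 0ℚ
  poch-vanishing zero    l = poch-0 l
  poch-vanishing (suc a) l = trans
    (cong (λ z → fromℤ (ℤ.- + suc a) ℚ.* poch z (suc (a ℕ.+ l))) (suc-neg a))
    (trans (cong (fromℤ (ℤ.- + suc a) ℚ.*_) (poch-vanishing a l)) (ℚ.*-zeroʳ (fromℤ (ℤ.- + suc a))))

  -- The coefficient of γ₂ᵢ in the formula for γ₂ₙ₊₁, where q = r+2i and l = 2(n-i)+1.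
  κ : ℤ → ℕ → ℚ
  κ q l = ℚ.- (poch q l ℚ.* ε l)

  divide-! : ∀ j p {c} y → p ℚ.* fromℤ (+ (j !)) ≡ c → p ℚ.* y ≡ c ℚ.* (exp j ℚ.* y)
  divide-! j p y refl = begin
    p ℚ.* y                           ≡⟨ cong (p ℚ.*_) (ℚ.*-identityˡ y) ⟨
    p ℚ.* (1ℚ ℚ.* y)                  ≡⟨ cong (λ z → p ℚ.* (z ℚ.* y)) (!-exp j) ⟨
    p ℚ.* (j! ℚ.* exp j ℚ.* y)        ≡⟨ solve 4 (λ p a e y → p :* (a :* e :* y) := p :* a :* (e :* y)) refl p j! (exp j) y ⟩
    p ℚ.* j! ℚ.* (exp j ℚ.* y)        ∎
    where
    open ≡-Reasoning
    open ℚ-Solver.+-*-Solver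
    j! : ℚ
    j! = fromℤ (+ (j !))

  κ-positive : ∀ j l → κ (+ suc j) (suc l) ≡ (x^ j ℕ.+ suc l -E) j
  κ-positive j l = trans
    (cong ℚ.-_ (divide-! j (poch (+ suc j) (suc l)) (ε (suc l)) (poch-positive j (suc l))))
    (sym (x^-E-coefficient j l))

  -- For even l the number `suc l` of negative factors is odd. This is the origin of the minus sign
  -- in the formulas for n ≤ -k-1.
  κ-negative : ∀ j l → sgn l ≡ 1ℚ → κ (ℤ.- + (j ℕ.+ suc l)) (suc l) ≡ ℚ.- (x^ j ℕ.+ suc l -E) j
  κ-negative j l sgn≡1 = cong ℚ.-_ (begin
    poch (ℤ.- + (j ℕ.+ suc l)) (suc l) ℚ.* ε (suc l)
      ≡⟨ divide-! j (poch (ℤ.- + (j ℕ.+ suc l)) (suc l)) (ε (suc l)) (poch-negative j (suc l)) ⟩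
    ℚ.- sgn l ℚ.* F ℚ.* y      ≡⟨ cong (λ z → ℚ.- z ℚ.* F ℚ.* y) sgn≡1 ⟩
    ℚ.- 1ℚ ℚ.* F ℚ.* y         ≡⟨ solve 2 (λ F y → con (ℚ.- 1ℚ) :* F :* y := :- (F :* y)) refl F y ⟩
    ℚ.- (F ℚ.* y)              ≡⟨ x^-E-coefficient j l ⟨
    (x^ j ℕ.+ suc l -E) j      ∎)
    where
    open ≡-Reasoning
    open ℚ-Solver.+-*-Solver
    F y : ℚ
    F = fromℤ (+ ((j ℕ.+ suc l) !))
    y = exp j ℚ.* ε (suc l)

  κ-vanishing : ∀ a l → κ (ℤ.- + a) (suc (a ℕ.+ l)) ≡ 0ℚ
  κ-vanishing a l = cong ℚ.-_ (trans (cong (ℚ._* ε (suc (a ℕ.+ l))) (poch-vanishing a l)) (ℚ.*-zeroˡ (ε (suc (a ℕ.+ l)))))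

  -- For N = b+1+d and lower entry b+1, the degrees are 2N = (2b+1) + (2d+1) and 2(b+1)-1 = 2b+1,
  -- the shape in which `x^-E-coefficient` applies.
  brack-suc : ∀ b d → brack (+ (suc b ℕ.+ d)) (+ suc b) ≡ (x^ suc (2 ℕ.* b) ℕ.+ suc (2 ℕ.* d) -E) (suc (2 ℕ.* b))
  brack-suc b d with suc b ℕ.≤? suc b ℕ.+ d
  ... | yes _ = cong₂ (λ m j → (x^ m -E) j)
                  (solve 2 (λ b d → con 2 :* (con 1 :+ b :+ d) := con 1 :+ con 2 :* b :+ (con 1 :+ con 2 :* d)) refl b d)
                  (ℕ.+-suc b (b ℕ.+ 0))
    where open ℕ-Solver.+-*-Solver
  ... | no ¬p = contradiction (ℕ.m≤m+n (suc b) d) ¬p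

  brace-≡ : ∀ b d → brace (+ (b ℕ.+ d)) (+ b) ≡ (x^ 2 ℕ.* b ℕ.+ suc (2 ℕ.* d) -E) (2 ℕ.* b)
  brace-≡ b d with b ℕ.≤? b ℕ.+ d
  ... | yes _ = cong (λ m → (x^ m -E) (2 ℕ.* b))
                  (solve 2 (λ b d → con 2 :* (b :+ d) :+ con 1 := con 2 :* b :+ (con 1 :+ con 2 :* d)) refl b d)
    where open ℕ-Solver.+-*-Solver
  ... | no ¬p = contradiction (ℕ.m≤m+n b d) ¬p

  brack-κ : ∀ j d → brack (+ (j ℕ.+ d)) (+ j) ≡ κ (+ (2 ℕ.* j)) (suc (2 ℕ.* d))
  -- The convention that the bracket is zero at lower entry 0 agrees with κ, whose rising factorial
  -- here starts with the factor 0.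
  brack-κ zero    d = sym (κ-vanishing 0 (2 ℕ.* d))
  brack-κ (suc j) d = trans (brack-suc j d) (trans (sym (κ-positive (suc (2 ℕ.* j)) (2 ℕ.* d)))
    (cong (λ z → κ (+ suc z) (suc (2 ℕ.* d))) (sym (ℕ.+-suc j (j ℕ.+ 0)))))

  brace-κ : ∀ j d → brace (+ (j ℕ.+ d)) (+ j) ≡ κ (+ suc (2 ℕ.* j)) (suc (2 ℕ.* d))
  brace-κ j d = trans (brace-≡ j d) (sym (κ-positive (2 ℕ.* j) (2 ℕ.* d)))

  -brack-κ : ∀ b d → ℚ.- brack (+ (suc b ℕ.+ d)) (+ suc b) ≡ κ (ℤ.- + (2 ℕ.* (suc b ℕ.+ d))) (suc (2 ℕ.* d))
  -brack-κ b d = trans (cong ℚ.-_ (brack-suc b d)) (trans (sym (κ-negative (suc (2 ℕ.* b)) (2 ℕ.* d) (sgn-even d)))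
    (cong (λ z → κ (ℤ.- + z) (suc (2 ℕ.* d)))
      (solve 2 (λ b d → con 1 :+ con 2 :* b :+ (con 1 :+ con 2 :* d) := con 2 :* (con 1 :+ b :+ d)) refl b d)))
    where open ℕ-Solver.+-*-Solver

  -brace-κ : ∀ b d → ℚ.- brace (+ (b ℕ.+ d)) (+ b) ≡ κ (ℤ.- + suc (2 ℕ.* (b ℕ.+ d))) (suc (2 ℕ.* d))
  -brace-κ b d = trans (cong ℚ.-_ (brace-≡ b d)) (trans (sym (κ-negative (2 ℕ.* b) (2 ℕ.* d) (sgn-even d)))
    (cong (λ z → κ (ℤ.- + z) (suc (2 ℕ.* d)))
      (solve 2 (λ b d → con 2 :* b :+ (con 1 :+ con 2 :* d) := con 1 :+ con 2 :* (b :+ d)) refl b d)))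
    where open ℕ-Solver.+-*-Solver

-- The operators M f

module Operators {c ℓ} (𝕂 : CommutativeRing c ℓ)
  (ι : ℚ → CommutativeRing.Carrier 𝕂)
  (ι-isHom : IsRingHomomorphism ℚ.+-*-rawRing (CommutativeRing.rawRing 𝕂) ι) where

  open CommutativeRing 𝕂 hiding (zero)
  open PowerSeries 𝕂
  open CommutativeSemigroupProperties +-commutativeSemigroup using (interchange)
  open CommutativeSemigroupProperties *-commutativeSemigroup using (x∙yz≈y∙xz; x∙yz≈xz∙y; xy∙z≈xz∙y)
    renaming (interchange to *-interchange)
  open RingProperties ring using (-‿distribˡ-*; -‿distribʳ-*; -1*x≈-x)
  open IsRingHomomorphism ι-isHom
  open ≈-Reasoning setoid
  private module S = CommutativeRing powerSeriesRing

  -- M q f γ n is the sum of (q+i)(q+i+1)⋯(q+n-1) · f (n-i) · γ i over 0 ≤ i ≤ n.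
  M : ℤ → Series → Series → Series
  M q f γ zero    = f 0 * γ 0
  M q f γ (suc n) = ι (poch q (suc n)) * f (suc n) * γ 0 + M (ℤ.suc q) f (tail γ) n

  M-cong : ∀ q {f f′ γ γ′} → f ≋ f′ → γ ≋ γ′ → M q f γ ≋ M q f′ γ′
  M-cong q f≈f′ γ≈γ′ zero    = *-cong (f≈f′ 0) (γ≈γ′ 0)
  M-cong q f≈f′ γ≈γ′ (suc n) = +-cong (*-cong (*-congˡ (f≈f′ (suc n))) (γ≈γ′ 0))
    (M-cong (ℤ.suc q) f≈f′ (λ i → γ≈γ′ (suc i)) n)

  M-congˡ : ∀ q f {γ γ′} → γ ≋ γ′ → M q f γ ≋ M q f γ′
  M-congˡ q f γ≈γ′ = M-cong q {f = f} (λ _ → refl) γ≈γ′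

  M-congʳ : ∀ q {f f′} γ → f ≋ f′ → M q f γ ≋ M q f′ γ
  M-congʳ q γ f≈f′ = M-cong q {γ = γ} f≈f′ (λ _ → refl)

  M-𝟙 : ∀ q γ → M q 𝟙 γ ≋ γ
  M-𝟙 q γ zero    = *-identityˡ (γ 0)
  M-𝟙 q γ (suc n) = begin
    ι (poch q (suc n)) * 0# * γ 0 + M (ℤ.suc q) 𝟙 (tail γ) n   ≈⟨ +-cong (trans (*-congʳ (zeroʳ _)) (zeroˡ _)) (M-𝟙 (ℤ.suc q) (tail γ) n) ⟩
    0# + γ (suc n)                                             ≈⟨ +-identityˡ _ ⟩
    γ (suc n)                                                  ∎

  M-⊕ : ∀ q f γ δ → M q f (γ ⊕ δ) ≋ M q f γ ⊕ M q f δ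
  M-⊕ q f γ δ zero    = distribˡ _ _ _
  M-⊕ q f γ δ (suc n) = trans (+-cong (distribˡ _ _ _) (M-⊕ (ℤ.suc q) f (tail γ) (tail δ) n)) (interchange _ _ _ _)

  M-· : ∀ q f a γ → M q f (a · γ) ≋ a · M q f γ
  M-· q f a γ zero    = x∙yz≈y∙xz _ _ _
  M-· q f a γ (suc n) = trans (+-cong (x∙yz≈y∙xz _ _ _) (M-· (ℤ.suc q) f a (tail γ) n)) (sym (distribˡ _ _ _))

  weight-closed : ∀ q (w : Series) → (∀ i → w (suc i) ≈ ι (fromℤ (q ℤ.+ + i)) * w i) →
                  ∀ n → w n ≈ ι (poch q n) * w 0
  weight-closed q w w-suc zero    = sym (trans (*-congʳ 1#-homo) (*-identityˡ _))
  weight-closed q w w-suc (suc n) = begin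
    w (suc n)                                             ≈⟨ w-suc n ⟩
    ι (fromℤ (q ℤ.+ + n)) * w n                           ≈⟨ *-congˡ (weight-closed q w w-suc n) ⟩
    ι (fromℤ (q ℤ.+ + n)) * (ι (poch q n) * w 0)          ≈⟨ *-assoc _ _ _ ⟨
    ι (fromℤ (q ℤ.+ + n)) * ι (poch q n) * w 0            ≈⟨ *-congʳ (trans (*-comm _ _) (sym (*-homo _ _))) ⟩
    ι (poch q n ℚ.* fromℤ (q ℤ.+ + n)) * w 0              ≈⟨ *-congʳ (⟦⟧-cong (≡.sym (poch-last q n))) ⟩
    ι (poch q (suc n)) * w 0                              ∎

  -- Telescoping: (q+i)⋯(q+n-1) · w i = w n no longer depends on i, so only the plain convolution of
  -- g and f remains under the sum.
  M-weighted : ∀ q f (w g : Series) → (∀ i → w (suc i) ≈ ι (fromℤ (q ℤ.+ + i)) * w i) →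
               M q f (λ i → w i * g i) ≋ (λ n → w n * (g ⊛ f) n)
  M-weighted q f w g w-suc zero    = trans (x∙yz≈y∙xz _ _ _) (*-congˡ (trans (*-comm _ _) (sym (+-identityʳ _))))
  M-weighted q f w g w-suc (suc n) = begin
    ι (poch q (suc n)) * f (suc n) * (w 0 * g 0) + M (ℤ.suc q) f (λ i → w (suc i) * g (suc i)) n
      ≈⟨ +-cong (*-interchange _ _ _ _) (M-weighted (ℤ.suc q) f (tail w) (tail g) tail-w-suc n) ⟩
    ι (poch q (suc n)) * w 0 * (f (suc n) * g 0) + w (suc n) * (tail g ⊛ f) n
      ≈⟨ +-congʳ (*-cong (weight-closed q w w-suc (suc n)) (*-comm _ _)) ⟨
    w (suc n) * (g 0 * f (suc n)) + w (suc n) * (tail g ⊛ f) n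
      ≈⟨ distribˡ _ _ _ ⟨
    w (suc n) * (g ⊛ f) (suc n) ∎
    where
    tail-w-suc : ∀ i → w (suc (suc i)) ≈ ι (fromℤ (ℤ.suc q ℤ.+ + i)) * w (suc i)
    tail-w-suc i = trans (w-suc (suc i)) (*-congʳ (⟦⟧-cong (≡.cong fromℤ (≡.sym (suc-+ q i)))))

  M-M : ∀ q f g γ → M q f (M q g γ) ≋ M q (g ⊛ f) γ
  M-M q f g γ zero    = trans (sym (*-assoc _ _ _)) (*-congʳ (trans (*-comm _ _) (sym (+-identityʳ _))))
  M-M q f g γ (suc n) = begin
    W * f (suc n) * (g 0 * γ 0) + M (ℤ.suc q) f ((λ i → ι (poch q (suc i)) * g (suc i) * γ 0) ⊕ M (ℤ.suc q) g (tail γ)) n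
      -- The tail of `M q g γ` is the contribution of `γ 0` plus the operator applied to `tail γ`.
      -- The former has rising factorials as weights and falls to `M-weighted`; the latter is the
      -- induction hypothesis.
      ≈⟨ +-congˡ (M-⊕ (ℤ.suc q) f (λ i → ι (poch q (suc i)) * g (suc i) * γ 0) (M (ℤ.suc q) g (tail γ)) n) ⟩
    W * f (suc n) * (g 0 * γ 0) + (M (ℤ.suc q) f (λ i → ι (poch q (suc i)) * g (suc i) * γ 0) n + M (ℤ.suc q) f (M (ℤ.suc q) g (tail γ)) n)
      ≈⟨ +-congˡ (+-cong first (M-M (ℤ.suc q) f g (tail γ) n)) ⟩
    W * f (suc n) * (g 0 * γ 0) + (W * (tail g ⊛ f) n * γ 0 + M (ℤ.suc q) (g ⊛ f) (tail γ) n)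
      ≈⟨ +-assoc _ _ _ ⟨
    W * f (suc n) * (g 0 * γ 0) + W * (tail g ⊛ f) n * γ 0 + M (ℤ.suc q) (g ⊛ f) (tail γ) n
      ≈⟨ +-congʳ (+-congʳ (trans (sym (*-assoc _ _ _)) (*-congʳ (trans (*-assoc _ _ _) (*-congˡ (*-comm _ _)))))) ⟩
    W * (g 0 * f (suc n)) * γ 0 + W * (tail g ⊛ f) n * γ 0 + M (ℤ.suc q) (g ⊛ f) (tail γ) n
      ≈⟨ +-congʳ (trans (*-congʳ (distribˡ _ _ _)) (distribʳ _ _ _)) ⟨
    W * (g ⊛ f) (suc n) * γ 0 + M (ℤ.suc q) (g ⊛ f) (tail γ) n ∎
    where
    W : Carrier
    W = ι (poch q (suc n))
    poch-suc : ∀ i → ι (poch q (suc (suc i))) ≈ ι (fromℤ (ℤ.suc q ℤ.+ + i)) * ι (poch q (suc i))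
    poch-suc i = begin
      ι (poch q (suc (suc i)))                                ≈⟨ ⟦⟧-cong (poch-last q (suc i)) ⟩
      ι (poch q (suc i) ℚ.* fromℤ (q ℤ.+ + suc i))            ≈⟨ trans (*-homo _ _) (*-comm _ _) ⟩
      ι (fromℤ (q ℤ.+ + suc i)) * ι (poch q (suc i))          ≈⟨ *-congʳ (⟦⟧-cong (≡.cong fromℤ (≡.sym (suc-+ q i)))) ⟩
      ι (fromℤ (ℤ.suc q ℤ.+ + i)) * ι (poch q (suc i))        ∎
    first : M (ℤ.suc q) f (λ i → ι (poch q (suc i)) * g (suc i) * γ 0) n ≈ W * (tail g ⊛ f) n * γ 0
    first = begin
      M (ℤ.suc q) f (λ i → ι (poch q (suc i)) * g (suc i) * γ 0) n
        ≈⟨ M-congˡ (ℤ.suc q) f (λ i → trans (*-congʳ (*-comm _ _)) (trans (xy∙z≈xz∙y _ _ _) (trans (*-comm _ _) (*-congˡ (*-comm _ _))))) n ⟩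
      M (ℤ.suc q) f (λ i → ι (poch q (suc i)) * (γ 0 · tail g) i) n
        ≈⟨ M-weighted (ℤ.suc q) f (λ i → ι (poch q (suc i))) (γ 0 · tail g) poch-suc n ⟩
      W * ((γ 0 · tail g) ⊛ f) n
        ≈⟨ *-congˡ (·-⊛ (γ 0) (tail g) f n) ⟩
      W * (γ 0 * (tail g ⊛ f) n)
        ≈⟨ x∙yz≈xz∙y _ _ _ ⟩
      W * (tail g ⊛ f) n * γ 0 ∎

  tail-alternate : ∀ γ → tail (alternate γ) ≋ - 1# · alternate (tail γ)
  tail-alternate γ n = trans (sym (-‿distribˡ-* _ _)) (sym (-1*x≈-x _))

  M-alternate : ∀ q f γ → M q (alternate f) (alternate γ) ≋ alternate (M q f γ)
  M-alternate q f γ zero    = trans (*-cong (*-identityˡ _) (*-identityˡ _)) (sym (*-identityˡ _))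
  M-alternate q f γ (suc n) = begin
    W * (- s * f (suc n)) * (1# * γ 0) + M (ℤ.suc q) (alternate f) (tail (alternate γ)) n
      ≈⟨ +-cong (*-cong (x∙yz≈y∙xz _ _ _) (*-identityˡ _)) (begin
           M (ℤ.suc q) (alternate f) (tail (alternate γ)) n             ≈⟨ M-congˡ (ℤ.suc q) (alternate f) (tail-alternate γ) n ⟩
           M (ℤ.suc q) (alternate f) (- 1# · alternate (tail γ)) n      ≈⟨ M-· (ℤ.suc q) (alternate f) (- 1#) (alternate (tail γ)) n ⟩
           - 1# * M (ℤ.suc q) (alternate f) (alternate (tail γ)) n      ≈⟨ *-congˡ (M-alternate (ℤ.suc q) f (tail γ) n) ⟩
           - 1# * (s * M (ℤ.suc q) f (tail γ) n)                        ≈⟨ trans (-1*x≈-x _) (-‿distribˡ-* _ _) ⟩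
           - s * M (ℤ.suc q) f (tail γ) n                               ∎) ⟩
    - s * (W * f (suc n)) * γ 0 + - s * M (ℤ.suc q) f (tail γ) n
      ≈⟨ +-congʳ (*-assoc _ _ _) ⟩
    - s * (W * f (suc n) * γ 0) + - s * M (ℤ.suc q) f (tail γ) n
      ≈⟨ distribˡ _ _ _ ⟨
    - s * M q f γ (suc n) ∎
    where
    W s : Carrier
    W = ι (poch q (suc n))
    s = sgn n

  -- The binomial series and the substitution x/(x-1)

  open Over 𝕂
  open RawSemiringDefs (RawRing.rawSemiring K⟦x⟧) using (_^_)
  open RawSemiringDefs (RawRing.rawSemiring rawRing) using (sum)

  -- (1 - x)^(-q)
  p : ℤ → Series
  p q l = ι (poch q l ℚ.* exp l)

  p-0 : p (+ 0) ≋ 𝟙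
  p-0 zero    = 1#-homo
  p-0 (suc l) = trans (⟦⟧-cong (≡.trans (≡.cong (ℚ._* exp (suc l)) (poch-0 l)) (ℚ.*-zeroˡ (exp (suc l))))) 0#-homo

  1-x-⊛ : ∀ f → 1-x ⊛ f ≋ f ⊕ (⊖ (x ⊛ f))
  1-x-⊛ f = S.trans (⊛-distribʳ f 𝟙 (⊖ x)) (S.+-cong (𝟙-⊛ f) (S.sym (S-‿distribˡ-* x f)))
    where open RingProperties S.ring renaming (-‿distribˡ-* to S-‿distribˡ-*)

  -- Pascal's rule read coefficientwise. Together with `p-0` it is what identifies `p q` with
  -- (1-x)^(-q) for integers q of either sign.
  1-x-⊛-p : ∀ q → 1-x ⊛ p (ℤ.suc q) ≋ p q
  1-x-⊛-p q zero    = trans (1-x-⊛ (p (ℤ.suc q)) zero) (trans (+-congˡ (trans (-‿cong (x-⊛-zero (p (ℤ.suc q)))) -0#≈0#)) (+-identityʳ _))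
    where open RingProperties ring using (-0#≈0#)
  1-x-⊛-p q (suc l) = begin
    (1-x ⊛ p (ℤ.suc q)) (suc l)                             ≈⟨ 1-x-⊛ (p (ℤ.suc q)) (suc l) ⟩
    p (ℤ.suc q) (suc l) + - (x ⊛ p (ℤ.suc q)) (suc l)       ≈⟨ +-congˡ (-‿cong (x-⊛-suc (p (ℤ.suc q)) l)) ⟩
    p (ℤ.suc q) (suc l) + - p (ℤ.suc q) l                   ≈⟨ trans (+-homo _ _) (+-congˡ (-‿homo _)) ⟨
    ι (poch (ℤ.suc q) (suc l) ℚ.* exp (suc l) ℚ.+ ℚ.- (poch (ℤ.suc q) l ℚ.* exp l)) ≈⟨ ⟦⟧-cong (poch-pascal q l) ⟩
    p q (suc l)                                             ∎

  1/[1-x] : Series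
  1/[1-x] = divide rawRing 1# 𝟙 1-x

  1/[1-x]-⊛-1-x : 1/[1-x] ⊛ 1-x ≋ 𝟙
  1/[1-x]-⊛-1-x = divide-⊛ 1# 𝟙 1-x (trans (*-identityˡ _) (trans (+-congˡ -0#≈0#) (+-identityʳ _)))
    where open RingProperties ring using (-0#≈0#)

  1/[1-x]-⊛-p : ∀ q → 1/[1-x] ⊛ p q ≋ p (ℤ.suc q)
  1/[1-x]-⊛-p q = S.trans (⊛-congˡ 1/[1-x] (S.sym (1-x-⊛-p q)))
    (S.trans (S.sym (⊛-assoc 1/[1-x] 1-x (p (ℤ.suc q))))
    (S.trans (⊛-congʳ (p (ℤ.suc q)) 1/[1-x]-⊛-1-x) (𝟙-⊛ (p (ℤ.suc q)))))

  ≡⇒p≋ : ∀ {q q′} → q ≡ q′ → p q ≋ p q′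
  ≡⇒p≋ ≡.refl _ = refl

  [1-x]^+-⊛-p : ∀ m q → (1-x ^ m) ⊛ p (+ m ℤ.+ q) ≋ p q
  [1-x]^+-⊛-p zero    q = S.trans (𝟙-⊛ (p (+ 0 ℤ.+ q))) (≡⇒p≋ (ℤ.+-identityˡ q))
  [1-x]^+-⊛-p (suc m) q =
    S.trans (⊛-congʳ (p (+ suc m ℤ.+ q)) (⊛-comm 1-x (1-x ^ m)))
    (S.trans (⊛-assoc (1-x ^ m) 1-x (p (+ suc m ℤ.+ q)))
    (S.trans (⊛-congˡ (1-x ^ m) (S.trans (⊛-congˡ 1-x (≡⇒p≋ (ℤ.+-assoc (+ 1) (+ m) q))) (1-x-⊛-p (+ m ℤ.+ q))))
    ([1-x]^+-⊛-p m q)))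

  1/[1-x]^-⊛-p : ∀ m q → (1/[1-x] ^ m) ⊛ p q ≋ p (+ m ℤ.+ q)
  1/[1-x]^-⊛-p zero    q = S.trans (𝟙-⊛ (p q)) (≡⇒p≋ (≡.sym (ℤ.+-identityˡ q)))
  1/[1-x]^-⊛-p (suc m) q =
    S.trans (⊛-assoc 1/[1-x] (1/[1-x] ^ m) (p q))
    (S.trans (⊛-congˡ 1/[1-x] (1/[1-x]^-⊛-p m q))
    (S.trans (1/[1-x]-⊛-p (+ m ℤ.+ q)) (≡⇒p≋ (≡.sym (ℤ.+-assoc (+ 1) (+ m) q)))))

  [1-x]^-⊛-p : ∀ r q → ([1-x]^ r) ⊛ p (r ℤ.+ q) ≋ p q
  [1-x]^-⊛-p (+ m)    q = [1-x]^+-⊛-p m q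
  [1-x]^-⊛-p -[1+ m ] q = S.trans (1/[1-x]^-⊛-p (suc m) (-[1+ m ] ℤ.+ q))
    (≡⇒p≋ (≡.trans (≡.sym (ℤ.+-assoc (+ suc m) -[1+ m ] q))
      (≡.trans (≡.cong (ℤ._+ q) (ℤ.+-inverseʳ (+ suc m))) (ℤ.+-identityˡ q))))

  x/[x-1]-⊛-p : ∀ q → x/[x-1] ⊛ p q ≋ - 1# · (x ⊛ p (ℤ.suc q))
  x/[x-1]-⊛-p q = S.trans (⊛-congˡ x/[x-1] (S.sym (1-x-⊛-p q)))
    (S.trans (S.sym (⊛-assoc x/[x-1] 1-x p′))
    (S.trans (⊛-congʳ p′ (S.trans (⊛-comm x/[x-1] 1-x) (S.trans (⊛-congʳ x/[x-1] 1-x≋)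
       (S.trans (·-⊛ (- 1#) x-1 x/[x-1]) (λ n → *-congˡ (trans (⊛-comm x-1 x/[x-1] n) (x/[x-1]-⊛ n)))))))
    (·-⊛ (- 1#) x p′)))
    where
    p′ : Series
    p′ = p (ℤ.suc q)
    open RingProperties ring using (-‿involutive)
    x/[x-1]-⊛ : x/[x-1] ⊛ x-1 ≋ x
    x/[x-1]-⊛ = divide-⊛ (- 1#) x x-1 (trans (*-congˡ (+-identityˡ _)) (trans (-1*x≈-x _) (-‿involutive 1#)))
    open AbelianGroupProperties +-abelianGroup using (⁻¹-∙-comm)
    1-x≋ : 1-x ≋ - 1# · x-1
    1-x≋ n = begin
      𝟙 n + - x n               ≈⟨ +-comm _ _ ⟩
      - x n + 𝟙 n               ≈⟨ +-congˡ (-‿involutive _) ⟨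
      - x n + - - 𝟙 n           ≈⟨ ⁻¹-∙-comm _ _ ⟩
      - (x n + - 𝟙 n)           ≈⟨ -1*x≈-x _ ⟨
      - 1# * (x n + - 𝟙 n)      ∎

  shift : ℕ → Series → Series
  shift zero    f n       = f n
  shift (suc i) f zero    = 0#
  shift (suc i) f (suc n) = shift i f n

  shift-cong : ∀ i {f g} → f ≋ g → shift i f ≋ shift i g
  shift-cong zero    f≈g n       = f≈g n
  shift-cong (suc i) f≈g zero    = refl
  shift-cong (suc i) f≈g (suc n) = shift-cong i f≈g n

  x-⊛-shift : ∀ i f → x ⊛ shift i f ≋ shift (suc i) f
  x-⊛-shift i f zero    = x-⊛-zero (shift i f)
  x-⊛-shift i f (suc n) = x-⊛-suc (shift i f) n

  ⊛-x-⊛ : ∀ f g → f ⊛ (x ⊛ g) ≋ x ⊛ (f ⊛ g)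
  ⊛-x-⊛ f g = S.trans (S.sym (⊛-assoc f x g)) (S.trans (⊛-congʳ g (⊛-comm f x)) (⊛-assoc x f g))

  ⊛-shift : ∀ f i g → f ⊛ shift i g ≋ shift i (f ⊛ g)
  ⊛-shift f zero    g = S.refl {f ⊛ g}
  ⊛-shift f (suc i) g = S.trans (⊛-congˡ f (S.sym (x-⊛-shift i g)))
    (S.trans (⊛-x-⊛ f (shift i g)) (S.trans (⊛-congˡ x (⊛-shift f i g)) (x-⊛-shift i (f ⊛ g))))

  x/[x-1]^ : ∀ i → x/[x-1] ^ i ≋ shift i (sgn i · p (+ i))
  x/[x-1]^ zero    n = trans (sym (p-0 n)) (sym (*-identityˡ _))
  x/[x-1]^ (suc i) = S.trans (⊛-congˡ x/[x-1] (x/[x-1]^ i))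
    (S.trans (⊛-shift x/[x-1] i (sgn i · p (+ i)))
    (S.trans (shift-cong i step)
    (S.trans (S.sym (⊛-shift x i (- sgn i · p (+ suc i)))) (x-⊛-shift i (- sgn i · p (+ suc i))))))
    where
    ⊛-· : ∀ f a g → f ⊛ (a · g) ≋ a · (f ⊛ g)
    ⊛-· f a g = S.trans (⊛-comm f (a · g)) (S.trans (·-⊛ a g f) (λ n → *-congˡ (⊛-comm g f n)))
    step : x/[x-1] ⊛ (sgn i · p (+ i)) ≋ x ⊛ (- sgn i · p (+ suc i))
    step n = begin
      (x/[x-1] ⊛ (sgn i · p (+ i))) n        ≈⟨ ⊛-· x/[x-1] (sgn i) (p (+ i)) n ⟩
      sgn i * (x/[x-1] ⊛ p (+ i)) n          ≈⟨ *-congˡ (x/[x-1]-⊛-p (+ i) n) ⟩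
      sgn i * (- 1# * (x ⊛ p (+ suc i)) n)   ≈⟨ *-congˡ (-1*x≈-x _) ⟩
      sgn i * - (x ⊛ p (+ suc i)) n          ≈⟨ trans (sym (-‿distribʳ-* _ _)) (-‿distribˡ-* _ _) ⟩
      - sgn i * (x ⊛ p (+ suc i)) n          ≈⟨ ⊛-· x (- sgn i) (p (+ suc i)) n ⟨
      (x ⊛ (- sgn i · p (+ suc i))) n        ∎

  -- ⨁ v is the sum of xⁱ · v i over all i.
  ⨁ : (ℕ → Series) → Series
  ⨁ v zero    = v 0 0
  ⨁ v (suc n) = v 0 (suc n) + ⨁ (λ i → v (suc i)) n

  ⨁-cong : ∀ {v w} → (∀ i → v i ≋ w i) → ⨁ v ≋ ⨁ w
  ⨁-cong v≈w zero    = v≈w 0 0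
  ⨁-cong v≈w (suc n) = +-cong (v≈w 0 (suc n)) (⨁-cong (λ i → v≈w (suc i)) n)

  ⨁-unfold : ∀ v → ⨁ v ≋ v 0 ⊕ (x ⊛ ⨁ (λ i → v (suc i)))
  ⨁-unfold v zero    = sym (trans (+-congˡ (x-⊛-zero (⨁ (λ i → v (suc i))))) (+-identityʳ _))
  ⨁-unfold v (suc n) = +-congˡ (sym (x-⊛-suc (⨁ (λ i → v (suc i))) n))

  -- Only the summands with i ≤ n reach degree n, so `⨁-unfold` reduces distributivity over the
  -- infinite sum to distributivity over two terms at a time.
  ⊛-⨁ : ∀ f v → f ⊛ ⨁ v ≋ ⨁ (λ i → f ⊛ v i)
  ⊛-⨁ f v zero    = refl
  ⊛-⨁ f v (suc n) = begin
    (f ⊛ ⨁ v) (suc n)                               ≈⟨ ⊛-congˡ f (⨁-unfold v) (suc n) ⟩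
    (f ⊛ (v 0 ⊕ (x ⊛ v′))) (suc n)                  ≈⟨ S.distribˡ f (v 0) (x ⊛ v′) (suc n) ⟩
    (f ⊛ v 0) (suc n) + (f ⊛ (x ⊛ v′)) (suc n)      ≈⟨ +-congˡ (trans (⊛-x-⊛ f v′ (suc n)) (x-⊛-suc (f ⊛ v′) n)) ⟩
    (f ⊛ v 0) (suc n) + (f ⊛ v′) n                  ≈⟨ +-congˡ (⊛-⨁ f (λ i → v (suc i)) n) ⟩
    ⨁ (λ i → f ⊛ v i) (suc n)                       ∎
    where
    v′ : Series
    v′ = ⨁ (λ i → v (suc i))

  -- The i-th summand begins in degree i; hence the truncation at i = n in `compose` loses nothing.
  sum-shift : ∀ (a : Series) (v : ℕ → Series) n →
              sum {suc n} (λ i → a (toℕ i) * shift (toℕ i) (v (toℕ i)) n) ≈ ⨁ (λ i → a i · v i) n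
  sum-shift a v zero    = +-identityʳ _
  sum-shift a v (suc n) = +-congˡ (sum-shift (tail a) (λ i → v (suc i)) n)

  open MonoidSum +-monoid using (sum-cong-≋)

  compose-x/[x-1] : ∀ γ → compose rawRing γ x/[x-1] ≋ ⨁ (λ i → alternate γ i · p (+ i))
  compose-x/[x-1] γ n = begin
    sum {suc n} (λ i → γ (toℕ i) * (x/[x-1] ^ toℕ i) n)                             ≈⟨ sum-cong-≋ {suc n} (λ i → *-congˡ {γ (toℕ i)} (x/[x-1]^ (toℕ i) n)) ⟩
    sum {suc n} (λ i → γ (toℕ i) * shift (toℕ i) (sgn (toℕ i) · p (+ toℕ i)) n)     ≈⟨ sum-shift γ (λ i → sgn i · p (+ i)) n ⟩
    ⨁ (λ i → γ i · (sgn i · p (+ i))) n                                             ≈⟨ ⨁-cong (λ i m → trans (sym (*-assoc _ _ _)) (*-congʳ (*-comm _ _))) n ⟩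
    ⨁ (λ i → alternate γ i · p (+ i)) n                                             ∎

  exp′ ε′ ε⁻¹′ : Series
  exp′ n = ι (exp n)
  ε′ n = ι (ε n)
  ε⁻¹′ n = ι (ε⁻¹ n)

  -- The coefficient of xⁿ⁻ⁱ in (1-x)^(-(q+i)) is (q+i)⋯(q+n-1)/(n-i)!, that is, the weight of `M`
  -- times a coefficient of eᵗ.
  M-exp : ∀ q γ → M q exp′ γ ≋ ⨁ (λ i → γ i · p (q ℤ.+ + i))
  M-exp q γ zero    = trans (*-comm _ _) (*-congˡ (⟦⟧-cong (≡.sym (ℚ.*-identityˡ (exp 0)))))
  M-exp q γ (suc n) = +-cong
    (trans (*-comm _ _) (*-congˡ (trans (sym (*-homo _ _)) (≡⇒p≋ (≡.sym (ℤ.+-identityʳ q)) (suc n)))))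
    (trans (M-exp (ℤ.suc q) (tail γ) n) (⨁-cong (λ i m → *-congˡ (≡⇒p≋ (suc-+ q i) m)) n))

  -- In each summand (1-x)^r turns (1-x)^(-r-i) into (1-x)^(-i), and (-x)ⁱ(1-x)^(-i) is the i-th
  -- power of x/(x-1).
  [1-x]^-⊛-M-exp : ∀ r γ → ([1-x]^ r) ⊛ M r exp′ (alternate γ) ≋ compose rawRing γ x/[x-1]
  [1-x]^-⊛-M-exp r γ = S.trans (⊛-congˡ ([1-x]^ r) (M-exp r (alternate γ)))
    (S.trans (⊛-⨁ ([1-x]^ r) (λ i → alternate γ i · p (r ℤ.+ + i)))
    (S.trans (⨁-cong term) (S.sym (compose-x/[x-1] γ))))
    where
    term : ∀ i → ([1-x]^ r) ⊛ (alternate γ i · p (r ℤ.+ + i)) ≋ alternate γ i · p (+ i)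
    term i = S.trans (⊛-comm ([1-x]^ r) (alternate γ i · p (r ℤ.+ + i)))
      (S.trans (·-⊛ (alternate γ i) (p (r ℤ.+ + i)) ([1-x]^ r))
      (λ n → *-congˡ (trans (⊛-comm (p (r ℤ.+ + i)) ([1-x]^ r) n) ([1-x]^-⊛-p r (+ i) n))))

  𝓕⇒M-exp : ∀ r γ → 𝓕 r γ → M r exp′ (alternate γ) ≋ γ
  𝓕⇒M-exp r γ γ∈𝓕 = ⊛-cancelˡ-invertible {h = [1-x]^ r} {v = p (r ℤ.+ + 0)}
    (S.trans ([1-x]^-⊛-p r (+ 0)) p-0) (S.trans ([1-x]^-⊛-M-exp r γ) γ∈𝓕)

  M-exp⇒𝓕 : ∀ r γ → M r exp′ (alternate γ) ≋ γ → 𝓕 r γ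
  M-exp⇒𝓕 r γ Mγ≈γ = S.trans (S.sym ([1-x]^-⊛-M-exp r γ)) (⊛-congˡ ([1-x]^ r) Mγ≈γ)

  -- The parity criterion

  private
    module ℚS = PowerSeries ℚ.+-*-commutativeRing

  ι-sgn : ∀ n → ι (ℚS.sgn n) ≈ sgn n
  ι-sgn zero    = 1#-homo
  ι-sgn (suc n) = trans (-‿homo _) (-‿cong (ι-sgn n))

  alternate-ε′ : alternate ε′ ≋ ε′ ⊛ exp′
  alternate-ε′ n = begin
    sgn n * ι (ε n)             ≈⟨ *-congʳ (ι-sgn n) ⟨
    ι (ℚS.sgn n) * ι (ε n)      ≈⟨ *-homo _ _ ⟨
    ι (ℚS.alternate ε n)        ≈⟨ ⟦⟧-cong (alternate-ε n) ⟩
    ι ((ε ℚS.⊛ exp) n)          ≈⟨ map-⊛ ℚ.+-*-commutativeRing 𝕂 ι-isHom ε exp n ⟩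
    (ε′ ⊛ exp′) n               ∎

  ε′-⊛-ε⁻¹′ : ε′ ⊛ ε⁻¹′ ≋ 𝟙
  ε′-⊛-ε⁻¹′ n = begin
    (ε′ ⊛ ε⁻¹′) n             ≈⟨ ⊛-comm ε′ ε⁻¹′ n ⟩
    (ε⁻¹′ ⊛ ε′) n             ≈⟨ map-⊛ ℚ.+-*-commutativeRing 𝕂 ι-isHom ε⁻¹ ε n ⟨
    ι ((ε⁻¹ ℚS.⊛ ε) n)        ≈⟨ ⟦⟧-cong (ε⁻¹-⊛ n) ⟩
    ι (ℚS.𝟙 n)                ≈⟨ map-constant ℚ.+-*-commutativeRing 𝕂 ι-isHom 1ℚ n ⟩
    constant rawRing (ι 1ℚ) n ≈⟨ constant-1 n ⟩
    𝟙 n                       ∎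
    where
    constant-1 : constant rawRing (ι 1ℚ) ≋ 𝟙
    constant-1 zero    = 1#-homo
    constant-1 (suc _) = refl

  alternate-M-ε : ∀ r γ → alternate (M r ε′ γ) ≋ M r ε′ (M r exp′ (alternate γ))
  alternate-M-ε r γ = S.trans (S.sym (M-alternate r ε′ γ))
    (S.trans (M-congʳ r (alternate γ) (S.trans alternate-ε′ (⊛-comm ε′ exp′)))
    (S.sym (M-M r ε′ exp′ (alternate γ))))

  M-ε-injective : ∀ r {γ δ} → M r ε′ γ ≋ M r ε′ δ → γ ≋ δ
  M-ε-injective r {γ} {δ} eq = S.trans (S.sym (retract γ)) (S.trans (M-congˡ r ε⁻¹′ eq) (retract δ))
    where
    retract : ∀ γ → M r ε⁻¹′ (M r ε′ γ) ≋ γ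
    retract γ = S.trans (M-M r ε⁻¹′ ε′ γ) (S.trans (M-congʳ r γ ε′-⊛-ε⁻¹′) (M-𝟙 r γ))

  -- 2 is invertible in 𝕂, with inverse `ι ½`.
  -x≈x⇒x≈0 : ∀ {a} → - a ≈ a → a ≈ 0#
  -x≈x⇒x≈0 {a} -a≈a = begin
    a                       ≈⟨ *-identityʳ _ ⟨
    a * 1#                  ≈⟨ *-congˡ (trans (sym (+-homo ½ ½)) 1#-homo) ⟨
    a * (ι ½ + ι ½)         ≈⟨ trans (distribˡ _ _ _) (sym (distribʳ _ _ _)) ⟩
    (a + a) * ι ½           ≈⟨ *-congʳ (trans (+-congˡ (sym -a≈a)) (-‿inverseʳ _)) ⟩
    0# * ι ½                ≈⟨ zeroˡ _ ⟩
    0#                      ∎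

  sgn-double : ∀ n → sgn (double n) ≈ 1#
  sgn-double zero    = refl
  sgn-double (suc n) = trans (-‿involutive _) (sgn-double n)
    where open RingProperties ring using (-‿involutive)

  𝓕⇒M-ε-odd : ∀ r γ → 𝓕 r γ → ∀ n → M r ε′ γ (suc (double n)) ≈ 0#
  𝓕⇒M-ε-odd r γ γ∈𝓕 n = -x≈x⇒x≈0 (begin
    - m                                         ≈⟨ -1*x≈-x _ ⟨
    - 1# * m                                    ≈⟨ *-congʳ (-‿cong (sgn-double n)) ⟨
    alternate (M r ε′ γ) (suc (double n))       ≈⟨ alternate-M-ε r γ (suc (double n)) ⟩
    M r ε′ (M r exp′ (alternate γ)) (suc (double n)) ≈⟨ M-congˡ r ε′ (𝓕⇒M-exp r γ γ∈𝓕) (suc (double n)) ⟩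
    m                                           ∎)
    where
    m : Carrier
    m = M r ε′ γ (suc (double n))

  M-ε-odd⇒𝓕 : ∀ r γ → (∀ n → M r ε′ γ (suc (double n)) ≈ 0#) → 𝓕 r γ
  M-ε-odd⇒𝓕 r γ odd≈0 = M-exp⇒𝓕 r γ (M-ε-injective r (S.trans (S.sym (alternate-M-ε r γ)) symmetric))
    where
    symmetric : alternate (M r ε′ γ) ≋ M r ε′ γ
    symmetric n with parity n
    ... | even m = trans (*-congʳ (sgn-double m)) (*-identityˡ _)
    ... | odd m  = trans (*-congˡ (odd≈0 m)) (trans (zeroʳ _) (sym (odd≈0 m)))

  -- The recurrence for the coefficients of odd index

  term : ℤ → Series → ℕ → ℕ → Carrier
  term r γ n i = ι (κ (r ℤ.+ + double i) (suc (double (n ℕ.∸ i)))) * γ (double i)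

  ι-κ : ∀ q l a → - (ι (κ q l) * a) ≈ ι (poch q l) * ε′ l * a
  ι-κ q l a = begin
    - (ι (κ q l) * a)           ≈⟨ -‿distribˡ-* _ _ ⟩
    - ι (κ q l) * a             ≈⟨ *-congʳ (trans (-‿cong (-‿homo _)) (-‿involutive _)) ⟩
    ι (poch q l ℚ.* ε l) * a    ≈⟨ *-congʳ (*-homo _ _) ⟩
    ι (poch q l) * ε′ l * a     ∎
    where open RingProperties ring using (-‿involutive)

  -- The induction removes γ₀ and γ₁ together, replacing r by r+2. In the inductive step γ₁ meets a
  -- coefficient of ε of positive even index and drops out; the last coefficient meets ε₀ = 1 in the
  -- base case.
  M-ε-odd : ∀ r γ n → M r ε′ γ (suc (double n)) ≈ γ (suc (double n)) + - sum {suc n} (λ i → term r γ n (toℕ i))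
  M-ε-odd r γ zero = begin
    ι (poch r 1) * ε′ 1 * γ 0 + ι (ε 0) * γ 1         ≈⟨ +-cong (sym (ι-κ r 1 (γ 0))) (trans (*-congʳ 1#-homo) (*-identityˡ _)) ⟩
    - (ι (κ r 1) * γ 0) + γ 1                         ≈⟨ +-comm _ _ ⟩
    γ 1 + - (ι (κ r 1) * γ 0)                         ≈⟨ +-congˡ (-‿cong (trans (+-identityʳ _) (*-congʳ (⟦⟧-cong (≡.cong (λ q → κ q 1) (ℤ.+-identityʳ r)))))) ⟨
    γ 1 + - (term r γ 0 0 + 0#)                       ∎
  M-ε-odd r γ (suc n) = begin
    ι (poch r l) * ε′ l * γ 0 + (ι (poch (ℤ.suc r) (double (suc n))) * ε′ (double (suc n)) * γ 1 + M (ℤ.suc (ℤ.suc r)) ε′ γ″ (suc (double n)))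
      ≈⟨ +-cong (sym (ι-κ r l (γ 0))) (+-cong (trans (*-congʳ (trans (*-congˡ ε≈0) (zeroʳ _))) (zeroˡ _)) (M-ε-odd (ℤ.suc (ℤ.suc r)) γ″ n)) ⟩
    - (ι (κ r l) * γ 0) + (0# + (γ l + - Σ))          ≈⟨ +-congˡ (+-identityˡ _) ⟩
    - (ι (κ r l) * γ 0) + (γ l + - Σ)                 ≈⟨ +-x∙yz≈y∙xz _ _ _ ⟩
    γ l + (- (ι (κ r l) * γ 0) + - Σ)                 ≈⟨ +-congˡ (⁻¹-∙-comm _ _) ⟩
    γ l + - (ι (κ r l) * γ 0 + Σ)                     ≈⟨ +-congˡ (-‿cong (+-cong (*-congʳ (⟦⟧-cong (≡.cong (λ q → κ q l) (≡.sym (ℤ.+-identityʳ r)))))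
                                                           (sum-cong-≋ {suc n} (λ i → *-congʳ {γ (suc (suc (double (toℕ i))))} (⟦⟧-cong (≡.cong (λ q → κ q (suc (double (n ℕ.∸ toℕ i))))
                                                              (≡.trans (suc-+ (ℤ.suc r) (double (toℕ i))) (suc-+ r (suc (double (toℕ i))))))))))) ⟩
    γ l + - sum {suc (suc n)} (λ i → term r γ (suc n) (toℕ i)) ∎
    where
    open CommutativeSemigroupProperties +-commutativeSemigroup using () renaming (x∙yz≈y∙xz to +-x∙yz≈y∙xz)
    open AbelianGroupProperties +-abelianGroup using (⁻¹-∙-comm)
    l : ℕ
    l = suc (double (suc n))
    γ″ : Series
    γ″ i = γ (suc (suc i))
    Σ : Carrier
    Σ = sum {suc n} (λ i → term (ℤ.suc (ℤ.suc r)) γ″ n (toℕ i))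
    ε≈0 : ε′ (double (suc n)) ≈ 0#
    ε≈0 = trans (⟦⟧-cong (≡.trans (≡.cong ε (double≡2* (suc n))) (ε-even n))) 0#-homo

  𝓕⇒odd-coefficients : ∀ r γ → 𝓕 r γ → ∀ n → γ (suc (double n)) ≈ sum {suc n} (λ i → term r γ n (toℕ i))
  𝓕⇒odd-coefficients r γ γ∈𝓕 n = x∙y⁻¹≈ε⇒x≈y _ _ (trans (sym (M-ε-odd r γ n)) (𝓕⇒M-ε-odd r γ γ∈𝓕 n))
    where open GroupProperties +-group using (x∙y⁻¹≈ε⇒x≈y)

  odd-coefficients⇒𝓕 : ∀ r γ → (∀ n → γ (suc (double n)) ≈ sum {suc n} (λ i → term r γ n (toℕ i))) → 𝓕 r γ
  odd-coefficients⇒𝓕 r γ eq = M-ε-odd⇒𝓕 r γ (λ n → trans (M-ε-odd r γ n) (trans (+-congʳ (eq n)) (-‿inverseʳ _)))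

open import Data.Integer.Base using (_+_; _-_; -_; _*_; _≤_; _<_; _⊔_)
open ℤ-Solver.+-*-Solver using (solve; _:+_; _:-_; :-_; _:*_; _:=_; con)

-- Sums over integer intervals

≤⇒∃ : ∀ {i j} → i ≤ j → ∃ λ n → j - i ≡ + n
≤⇒∃ {i} {j} i≤j with j - i | ℤ.i≤j⇒0≤j-i i≤j
... | + n | _ = n , ≡.refl

≤-<-connex : ∀ i j → i ≤ j ⊎ j < i
≤-<-connex i j with i ℤ.≤? j
... | yes i≤j = inj₁ i≤j
... | no  i≰j = inj₂ (ℤ.≰⇒> i≰j)

even-or-odd : ∀ r → (∃ λ k → r ≡ + 2 * k) ⊎ (∃ λ k → r ≡ + 2 * k + + 1)
even-or-odd r with r ℤ.%ℕ 2 | ℤ.a≡a%ℕn+[a/ℕn]*n r 2 | ℤ.n%ℕd<d r 2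
... | 0           | eq | _ = inj₁ (r ℤ./ℕ 2 , ≡.trans eq (solve 1 (λ k → con (+ 0) :+ k :* con (+ 2) := con (+ 2) :* k) ≡.refl (r ℤ./ℕ 2)))
... | 1           | eq | _ = inj₂ (r ℤ./ℕ 2 , ≡.trans eq (solve 1 (λ k → con (+ 1) :+ k :* con (+ 2) := con (+ 2) :* k :+ con (+ 1)) ≡.refl (r ℤ./ℕ 2)))
... | suc (suc _) | eq | ℕ.s≤s (ℕ.s≤s ())

module Sums {c ℓ} (𝕂 : CommutativeRing c ℓ) where
  open CommutativeRing 𝕂 using (Carrier; _≈_; 0#; rawRing; +-monoid; trans; sym; refl; reflexive; +-identityˡ; +-congʳ)
  open Over 𝕂
  open RawSemiringDefs (RawRing.rawSemiring rawRing) using (sum)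
  open MonoidSum +-monoid using (sum-cong-≋)

  -- `∑` is stuck on the sign of b - a; an equation with a natural number releases it.
  ∑-sum : ∀ a b m f → b - a ≡ + m → ∑ a b f ≡ sum {suc m} (λ j → f (a + + toℕ j))
  ∑-sum a b m f eq with b - a | eq
  ... | _ | ≡.refl = ≡.refl

  -- The complement d of j in m is passed along because the identities for κ are indexed by j and
  -- j+d.
  ∑-cong : ∀ a b m f g → b - a ≡ + m → (∀ j d → j ℕ.+ d ≡ m → f (a + + j) ≈ g (a + + j)) → ∑ a b f ≈ ∑ a b g
  ∑-cong a b m f g eq f≈g = trans (reflexive (∑-sum a b m f eq))
    (trans (sum-cong-≋ {suc m} {λ j → f (a + + toℕ j)} {λ j → g (a + + toℕ j)}
             (λ j → f≈g (toℕ j) (m ℕ.∸ toℕ j) (ℕ.m+[n∸m]≡n (ℕ.≤-pred (Fin.toℕ<n j)))))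
           (reflexive (≡.sym (∑-sum a b m g eq))))

  sum-drop : ∀ d m (g : ℕ → Carrier) → (∀ j → j ℕ.< d → g j ≈ 0#) →
             sum {suc (d ℕ.+ m)} (λ j → g (toℕ j)) ≈ sum {suc m} (λ j → g (d ℕ.+ toℕ j))
  sum-drop zero    m g g≈0 = refl
  sum-drop (suc d) m g g≈0 = trans (+-congʳ (g≈0 0 (ℕ.s≤s ℕ.z≤n)))
    (trans (+-identityˡ _) (sum-drop d m (λ j → g (suc j)) (λ j j<d → g≈0 (suc j) (ℕ.s≤s j<d))))

  ∑-drop : ∀ a b d m f → b - (a + + d) ≡ + m → (∀ j → j ℕ.< d → f (a + + j) ≈ 0#) →
           ∑ a b f ≈ ∑ (a + + d) b f
  ∑-drop a b d m f eq f≈0 = trans (reflexive (∑-sum a b (d ℕ.+ m) f eq′))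
    (trans (sum-drop d m (λ j → f (a + + j)) f≈0)
    (trans (sum-cong-≋ {suc m} {λ j → f (a + + (d ℕ.+ toℕ j))} {λ j → f (a + + d + + toℕ j)}
             (λ j → reflexive (≡.cong f (≡.sym (ℤ.+-assoc a (+ d) (+ toℕ j))))))
           (reflexive (≡.sym (∑-sum (a + + d) b m f eq)))))
    where
    eq′ : b - a ≡ + (d ℕ.+ m)
    eq′ = ≡.trans (solve 3 (λ a b d → b :- a := d :+ (b :- (a :+ d))) ≡.refl a b (+ d)) (≡.cong (λ z → + d + z) eq)

+double : ∀ n → + double n ≡ + 2 * + n
+double n = ≡.trans (≡.cong +_ (double≡2* n)) (ℤ.pos-* 2 n)

-- The even and odd cases of the theorem are the cases δ = 0 and δ = 1.
module Cases (δ : ℕ) (B C : ℤ → ℤ → ℚ)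
  (B-κ : ∀ j d → B (+ (j ℕ.+ d)) (+ j) ≡ κ (+ δ + + 2 * + j) (suc (double d)))
  (C-κ : ∀ b d → ℚ.- C (+ (suc b ℕ.+ d)) (+ suc b) ≡ κ (- (+ 2 * + (suc b ℕ.+ d)) + + δ) (suc (double d)))
  (κ≡0 : ∀ e t → κ (- (+ 2 * + suc e) + + δ) (suc (double (suc e ℕ.+ t))) ≡ 0ℚ)
  {c ℓ} (𝕂 : CommutativeRing c ℓ)
  (ι : ℚ → CommutativeRing.Carrier 𝕂)
  (ι-isHom : IsRingHomomorphism +-*-rawRing (CommutativeRing.rawRing 𝕂) ι)
  (γ : ℕ → CommutativeRing.Carrier 𝕂) where

  private module K = CommutativeRing 𝕂
  open K using (_≈_; 0#; rawRing; trans; sym; reflexive)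
  open Over 𝕂
  open Sums 𝕂
  open Operators 𝕂 ι ι-isHom using (term; 𝓕⇒odd-coefficients; odd-coefficients⇒𝓕)
  open IsRingHomomorphism ι-isHom using (⟦⟧-cong; 0#-homo; -‿homo)
  open RawSemiringDefs (RawRing.rawSemiring rawRing) using (sum)

  -- `term` extended to integer indices, so that sums starting at -k and at 0 share one summand. All
  -- sums end at n, where the absolute value is just n - i.
  T : ℤ → ℕ → ℤ → K.Carrier
  T r n i = ι (κ (r + + 2 * i) (suc (double ℤ.∣ + n - i ∣))) K.* γ ⟨ + 2 * i ⟩

  T-cong : ∀ {r n i q d} → r + + 2 * i ≡ q → + n - i ≡ + d → T r n i ≈ ι (κ q (suc (double d))) K.* γ ⟨ + 2 * i ⟩
  T-cong {r} {n} {i} eq₁ eq₂ = K.*-congʳ (⟦⟧-cong (≡.cong₂ (λ q d → κ q (suc (double d))) eq₁ (≡.cong ℤ.∣_∣ eq₂)))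

  m+n-m≡n : ∀ j d → + (j ℕ.+ d) - + j ≡ + d
  m+n-m≡n j d = solve 2 (λ j d → j :+ d :- j := d) ≡.refl (+ j) (+ d)

  sum-term : ∀ r n → sum {suc n} (λ i → term r γ n (toℕ i)) ≈ ∑ (+ 0) (+ n) (T r n)
  sum-term r n = trans (sum-cong-≋ {suc n} (λ i → term≈T (toℕ i) (n ℕ.∸ toℕ i) (ℕ.m+[n∸m]≡n (ℕ.≤-pred (Fin.toℕ<n i)))))
    (reflexive (≡.sym (∑-sum (+ 0) (+ n) n (T r n) (ℤ.+-identityʳ (+ n)))))
    where
    open MonoidSum K.+-monoid using (sum-cong-≋)
    term≈T : ∀ j d → j ℕ.+ d ≡ n → term r γ n j ≈ T r n (+ j)
    term≈T j d ≡.refl = trans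
      (K.*-cong (⟦⟧-cong (≡.cong₂ (λ q d → κ (r + q) (suc (double d))) (+double j) (ℕ.m+n∸m≡n j d))) (reflexive (≡.cong (γ ⟨_⟩) (+double j))))
      (sym (T-cong {r} {j ℕ.+ d} {+ j} ≡.refl (m+n-m≡n j d)))

  -- For k ≥ 0 the additional indices -k ≤ i < 0 meet γ₂ᵢ = 0. For k < 0 and 0 ≤ i < -k the factors
  -- of the rising factorial run from r+2i < 0 to r+2n ≥ 0 and include 0.
  vanishing : ∀ k n m → + n - - k ≡ + m → ∑ (- k) (+ n) (T (+ 2 * k + + δ) n) ≈ ∑ (+ 0) (+ n) (T (+ 2 * k + + δ) n)
  vanishing (+ K) n m _ =
    trans (∑-drop (- + K) (+ n) K n (T r n) (≡.trans (≡.cong (λ z → + n - z) (ℤ.+-inverseˡ (+ K))) (ℤ.+-identityʳ (+ n))) γ≈0)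
          (reflexive (≡.cong (λ a → ∑ a (+ n) (T r n)) (ℤ.+-inverseˡ (+ K))))
    where
    r : ℤ
    r = + 2 * + K + + δ
    γ≈0 : ∀ j → j ℕ.< K → T r n (- + K + + j) ≈ 0#
    γ≈0 j j<K = let e , eq = ℕ.m≤n⇒∃[o]m+o≡n j<K in
      trans (K.*-congˡ (reflexive (≡.cong (λ i → γ ⟨ + 2 * i ⟩)
        (≡.trans (≡.cong (λ K → - + K + + j) (≡.sym eq))
          (solve 2 (λ j e → :- (con (+ 1) :+ j :+ e) :+ j := :- (con (+ 1) :+ e)) ≡.refl (+ j) (+ e))))))
        (K.zeroʳ _)
  vanishing -[1+ K ] n m eq = sym (∑-drop (+ 0) (+ n) (suc K) m (T r n) eq T≈0)
    where
    r : ℤ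
    r = + 2 * -[1+ K ] + + δ
    T≈0 : ∀ j → j ℕ.< suc K → T r n (+ j) ≈ 0#
    -- Here e = -k-1-j and m = n+k, whence n-j = (e+1)+m.
    T≈0 j (ℕ.s≤s j≤K) = trans (T-cong {r} {n} {+ j} index length)
        (trans (K.*-congʳ (trans (⟦⟧-cong (κ≡0 e m)) 0#-homo)) (K.zeroˡ _))
      where
      e : ℕ
      e = proj₁ (ℕ.m≤n⇒∃[o]m+o≡n j≤K)
      K≡j+e : K ≡ j ℕ.+ e
      K≡j+e = ≡.sym (proj₂ (ℕ.m≤n⇒∃[o]m+o≡n j≤K))
      index : r + + 2 * + j ≡ - (+ 2 * + suc e) + + δ
      index = ≡.trans (≡.cong (λ K → + 2 * -[1+ K ] + + δ + + 2 * + j) K≡j+e) (solve 3 (λ j e δ → con (+ 2) :* (:- (con (+ 1) :+ (j :+ e))) :+ δ :+ con (+ 2) :* j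
                := :- (con (+ 2) :* (con (+ 1) :+ e)) :+ δ) ≡.refl (+ j) (+ e) (+ δ))
      length : + n - + j ≡ + (suc e ℕ.+ m)
      length = ≡.trans (solve 3 (λ n j e → n :- j := con (+ 1) :+ e :+ (n :- (con (+ 1) :+ (j :+ e)))) ≡.refl (+ n) (+ j) (+ e))
        (≡.cong (λ z → + suc e + z) (≡.trans (≡.cong (λ K → + n - + suc K) (≡.sym K≡j+e)) eq))

  -- For i = -k+j the lower entry i+k is j and r+2i = δ+2j, so the first argument of κ no longer
  -- depends on k.
  high-sum : ∀ k n m → + n - - k ≡ + m →
    (∑[ - k ≤ i ≤ + n ] ι (B (+ n + k) (i + k)) K.* γ ⟨ + 2 * i ⟩) ≈ ∑ (- k) (+ n) (T (+ 2 * k + + δ) n)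
  high-sum k n m eq = ∑-cong (- k) (+ n) m (λ i → ι (B (+ n + k) (i + k)) K.* γ ⟨ + 2 * i ⟩) (T (+ 2 * k + + δ) n) eq coefficient
    where
    coefficient : ∀ j d → j ℕ.+ d ≡ m →
      ι (B (+ n + k) (- k + + j + k)) K.* γ ⟨ + 2 * (- k + + j) ⟩ ≈ T (+ 2 * k + + δ) n (- k + + j)
    coefficient j d ≡.refl = trans
      (K.*-congʳ (⟦⟧-cong (≡.trans
        (≡.cong₂ B (≡.trans (≡.cong (λ z → + n + z) (≡.sym (ℤ.neg-involutive k))) eq)
                   (solve 2 (λ k j → :- k :+ j :+ k := j) ≡.refl k (+ j)))
        (B-κ j d))))
      (sym (T-cong {+ 2 * k + + δ} {n} { - k + + j}
        (solve 3 (λ k j δ → con (+ 2) :* k :+ δ :+ con (+ 2) :* (:- k :+ j) := δ :+ con (+ 2) :* j) ≡.refl k (+ j) (+ δ))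
        (≡.trans (solve 3 (λ n k j → n :- (:- k :+ j) := n :- :- k :- j) ≡.refl (+ n) k (+ j))
                 (≡.trans (≡.cong (_- + j) eq) (m+n-m≡n j d)))))

  -- The slack b = -k-1-n turns the arguments of C into -k-n = b+1 and -k-i = b+1+(n-i), while r+2i
  -- = -2(-k-i)+δ.
  low-sum : ∀ k n b → - k - + 1 - + n ≡ + b →
    (∑[ + 0 ≤ i ≤ + n ] (K.- ι (C (- k - i) (- k - + n))) K.* γ ⟨ + 2 * i ⟩) ≈ ∑ (+ 0) (+ n) (T (+ 2 * k + + δ) n)
  low-sum k n b eq = ∑-cong (+ 0) (+ n) n (λ i → (K.- ι (C (- k - i) (- k - + n))) K.* γ ⟨ + 2 * i ⟩) (T (+ 2 * k + + δ) n)
    (ℤ.+-identityʳ (+ n)) coefficient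
    where
    coefficient : ∀ j d → j ℕ.+ d ≡ n →
      (K.- ι (C (- k - + j) (- k - + n))) K.* γ ⟨ + 2 * + j ⟩ ≈ T (+ 2 * k + + δ) n (+ j)
    coefficient j d ≡.refl = trans
      (K.*-congʳ (trans (sym (-‿homo _)) (⟦⟧-cong (≡.trans (≡.cong₂ (λ y z → ℚ.- C y z) eq₁ eq₂) (C-κ b d)))))
      (sym (T-cong {+ 2 * k + + δ} {j ℕ.+ d} {+ j}
        (≡.trans (solve 3 (λ k j δ → con (+ 2) :* k :+ δ :+ con (+ 2) :* j := :- (con (+ 2) :* (:- k :- j)) :+ δ) ≡.refl k (+ j) (+ δ))
                 (≡.cong (λ z → - (+ 2 * z) + + δ) eq₁))
        (m+n-m≡n j d)))
      where
      eq₁ : - k - + j ≡ + (suc b ℕ.+ d)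
      eq₁ = ≡.trans (solve 3 (λ k j d → :- k :- j := con (+ 1) :+ (:- k :- con (+ 1) :- (j :+ d)) :+ d) ≡.refl k (+ j) (+ d))
        (≡.cong (λ z → + 1 + z + + d) eq)
      eq₂ : - k - + (j ℕ.+ d) ≡ + suc b
      eq₂ = ≡.trans (solve 2 (λ k n → :- k :- n := con (+ 1) :+ (:- k :- con (+ 1) :- n)) ≡.refl k (+ (j ℕ.+ d)))
        (≡.cong (λ z → + 1 + z) eq)

  Conditions : ℤ → Set ℓ
  Conditions k =
      (∀ n → + 0 ⊔ (- k) ≤ n →
        γ ⟨ + 2 * n + + 1 ⟩ ≈ (∑[ - k ≤ i ≤ n ] ι (B (n + k) (i + k)) K.* γ ⟨ + 2 * i ⟩))
    × (k < + 0 → ∀ n → + 0 ≤ n → n ≤ - k - + 1 →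
        γ ⟨ + 2 * n + + 1 ⟩ ≈ (∑[ + 0 ≤ i ≤ n ] (K.- ι (C (- k - i) (- k - n))) K.* γ ⟨ + 2 * i ⟩))

  γ⟨odd⟩ : ∀ n → γ ⟨ + 2 * + n + + 1 ⟩ ≡ γ (suc (double n))
  γ⟨odd⟩ n = ≡.cong (γ ⟨_⟩) (≡.trans (≡.cong (_+ + 1) (≡.sym (+double n))) (≡.cong +_ (ℕ.+-comm (double n) 1)))

  𝓕⇒Conditions : ∀ k → 𝓕 (+ 2 * k + + δ) γ → Conditions k
  𝓕⇒Conditions k γ∈𝓕 = high , low
    where
    r : ℤ
    r = + 2 * k + + δ
    odd≈ : ∀ n → γ ⟨ + 2 * + n + + 1 ⟩ ≈ ∑ (+ 0) (+ n) (T r n)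
    odd≈ n = trans (reflexive (γ⟨odd⟩ n)) (trans (𝓕⇒odd-coefficients r γ γ∈𝓕 n) (sum-term r n))
    high : ∀ n → + 0 ⊔ (- k) ≤ n → γ ⟨ + 2 * n + + 1 ⟩ ≈ (∑[ - k ≤ i ≤ n ] ι (B (n + k) (i + k)) K.* γ ⟨ + 2 * i ⟩)
    high (+ n)    -k≤n = let m , eq = ≤⇒∃ (ℤ.≤-trans (ℤ.i≤j⊔i (+ 0) (- k)) -k≤n) in
      trans (odd≈ n) (sym (trans (high-sum k n m eq) (vanishing k n m eq)))
    high -[1+ _ ] 0≤n = contradiction (ℤ.≤-trans (ℤ.i≤i⊔j (+ 0) (- k)) 0≤n) λ ()
    low : k < + 0 → ∀ n → + 0 ≤ n → n ≤ - k - + 1 →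
      γ ⟨ + 2 * n + + 1 ⟩ ≈ (∑[ + 0 ≤ i ≤ n ] (K.- ι (C (- k - i) (- k - n))) K.* γ ⟨ + 2 * i ⟩)
    low _ (+ n) _ n≤-k-1 = let b , eq = ≤⇒∃ n≤-k-1 in
      trans (odd≈ n) (sym (low-sum k n b eq))

  Conditions⇒𝓕 : ∀ k → Conditions k → 𝓕 (+ 2 * k + + δ) γ
  Conditions⇒𝓕 k (high , low) = odd-coefficients⇒𝓕 r γ (λ n →
      trans (reflexive (≡.sym (γ⟨odd⟩ n))) (trans (odd≈ n) (sym (sum-term r n))))
    where
    r : ℤ
    r = + 2 * k + + δ
    odd≈-high : ∀ n → - k ≤ + n → γ ⟨ + 2 * + n + + 1 ⟩ ≈ ∑ (+ 0) (+ n) (T r n)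
    odd≈-high n -k≤n = let m , eq = ≤⇒∃ -k≤n in
      trans (high (+ n) (ℤ.⊔-lub (ℤ.+≤+ ℕ.z≤n) -k≤n)) (trans (high-sum k n m eq) (vanishing k n m eq))
    odd≈-low : ∀ n → + n < - k → γ ⟨ + 2 * + n + + 1 ⟩ ≈ ∑ (+ 0) (+ n) (T r n)
    odd≈-low n n<-k = let b , eq = ≤⇒∃ n≤-k-1 in
      -- The premise k < 0 follows from 0 ≤ n < -k.
      trans (low (ℤ.neg-cancel-< (ℤ.≤-<-trans (ℤ.+≤+ ℕ.z≤n) n<-k)) (+ n) (ℤ.+≤+ ℕ.z≤n) n≤-k-1) (low-sum k n b eq)
      where
      n≤-k-1 : + n ≤ - k - + 1
      n≤-k-1 = ≡.subst (+ n ≤_) (ℤ.+-comm (- + 1) (- k)) (ℤ.i<j⇒i≤pred[j] n<-k)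
    odd≈ : ∀ n → γ ⟨ + 2 * + n + + 1 ⟩ ≈ ∑ (+ 0) (+ n) (T r n)
    odd≈ n = [ odd≈-high n , odd≈-low n ]′ (≤-<-connex (- k) (+ n))

-- The coefficients for even and odd r

even-B-κ : ∀ j d → brack (+ (j ℕ.+ d)) (+ j) ≡ κ (+ 0 + + 2 * + j) (suc (double d))
even-B-κ j d = ≡.trans (brack-κ j d) (≡.cong₂ (λ q l → κ q (suc l)) (≡.trans (ℤ.pos-* 2 j) (≡.sym (ℤ.+-identityˡ (+ 2 * + j)))) (≡.sym (double≡2* d)))

odd-B-κ : ∀ j d → brace (+ (j ℕ.+ d)) (+ j) ≡ κ (+ 1 + + 2 * + j) (suc (double d))
odd-B-κ j d = ≡.trans (brace-κ j d) (≡.cong₂ (λ q l → κ q (suc l)) (≡.cong (λ z → + 1 + z) (ℤ.pos-* 2 j)) (≡.sym (double≡2* d)))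

even-C-κ : ∀ b d → ℚ.- brack (+ (suc b ℕ.+ d)) (+ suc b) ≡ κ (- (+ 2 * + (suc b ℕ.+ d)) + + 0) (suc (double d))
even-C-κ b d = ≡.trans (-brack-κ b d) (≡.cong₂ (λ q l → κ q (suc l))
  (≡.trans (≡.cong -_ (ℤ.pos-* 2 (suc b ℕ.+ d))) (≡.sym (ℤ.+-identityʳ (- (+ 2 * + (suc b ℕ.+ d)))))) (≡.sym (double≡2* d)))

-[2*suc]+1 : ∀ a → - + suc (2 ℕ.* a) ≡ - (+ 2 * + suc a) + + 1
-[2*suc]+1 a = ≡.trans (≡.cong (λ z → - (+ 1 + z)) (ℤ.pos-* 2 a))
  (solve 1 (λ a → :- (con (+ 1) :+ con (+ 2) :* a) := :- (con (+ 2) :* (con (+ 1) :+ a)) :+ con (+ 1)) ≡.refl (+ a))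

-- For r = 2k+1 the negative of r+2i is 2(-k-i-1)+1, the degree of the Euler polynomial involved;
-- this is why both entries of the brace are lowered by one.
odd-C-κ : ∀ b d → ℚ.- brace (+ (suc b ℕ.+ d) - + 1) (+ suc b - + 1) ≡ κ (- (+ 2 * + (suc b ℕ.+ d)) + + 1) (suc (double d))
odd-C-κ b d = ≡.trans (-brace-κ b d) (≡.cong₂ (λ q l → κ q (suc l)) (-[2*suc]+1 (b ℕ.+ d)) (≡.sym (double≡2* d)))

even-κ≡0 : ∀ e t → κ (- (+ 2 * + suc e) + + 0) (suc (double (suc e ℕ.+ t))) ≡ 0ℚ
even-κ≡0 e t = ≡.trans
  (≡.cong₂ (λ q l → κ q (suc l)) (≡.trans (ℤ.+-identityʳ (- (+ 2 * + suc e))) (≡.cong -_ (≡.sym (ℤ.pos-* 2 (suc e)))))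
    (≡.trans (double≡2* (suc e ℕ.+ t)) (ℕ.*-distribˡ-+ 2 (suc e) t)))
  (κ-vanishing (2 ℕ.* suc e) (2 ℕ.* t))

odd-κ≡0 : ∀ e t → κ (- (+ 2 * + suc e) + + 1) (suc (double (suc e ℕ.+ t))) ≡ 0ℚ
odd-κ≡0 e t = ≡.trans
  (≡.cong₂ (λ q l → κ q (suc l)) (≡.sym (-[2*suc]+1 e))
    (≡.trans (double≡2* (suc e ℕ.+ t)) (ℕS.solve 2 (λ e t → ℕS.con 2 ℕS.:* (ℕS.con 1 ℕS.:+ e ℕS.:+ t) ℕS.:= ℕS.con 1 ℕS.:+ ℕS.con 2 ℕS.:* e ℕS.:+ (ℕS.con 1 ℕS.:+ ℕS.con 2 ℕS.:* t)) ≡.refl e t)))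
  -- The factors run from -(2e+1) to 2t+1, both ends odd, whereas for even r they run from -2(e+1)
  -- to 2t.
  (κ-vanishing (suc (2 ℕ.* e)) (1 ℕ.+ 2 ℕ.* t))
  where module ℕS = ℕ-Solver.+-*-Solver

module Even {c ℓ} = Cases 0 brack brack even-B-κ even-C-κ even-κ≡0 {c} {ℓ}
module Odd {c ℓ} = Cases 1 brace (λ i j → brace (i - + 1) (j - + 1)) odd-B-κ odd-C-κ odd-κ≡0 {c} {ℓ}

-- The field is represented by any commutative ring with a homomorphism ι from ℚ. The parity of r is
-- expressed by two conjuncts, each conditional on a representation of r by k, so that for a given r
-- one of them is vacuous.
theorem5p3 : ∀ {c ℓ} (𝕂 : CommutativeRing c ℓ) →
    let module K = CommutativeRing 𝕂
        open Over 𝕂 in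
    (ι : ℚ → K.Carrier) → IsRingHomomorphism +-*-rawRing K.rawRing ι →
    (γ : ℕ → K.Carrier) (r : ℤ) →
    𝓕 r γ ⇔
      ( (∀ k → r ≡ + 2 * k →
          (∀ n → + 0 ⊔ (- k) ≤ n →
            γ ⟨ + 2 * n + + 1 ⟩ K.≈ (∑[ - k ≤ i ≤ n ] ι (brack (n + k) (i + k)) K.* γ ⟨ + 2 * i ⟩))
          × (k < + 0 → ∀ n → + 0 ≤ n → n ≤ - k - + 1 →
            γ ⟨ + 2 * n + + 1 ⟩ K.≈ (∑[ + 0 ≤ i ≤ n ] (K.- ι (brack (- k - i) (- k - n))) K.* γ ⟨ + 2 * i ⟩)))
      × (∀ k → r ≡ + 2 * k + + 1 →
          (∀ n → + 0 ⊔ (- k) ≤ n →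
            γ ⟨ + 2 * n + + 1 ⟩ K.≈ (∑[ - k ≤ i ≤ n ] ι (brace (n + k) (i + k)) K.* γ ⟨ + 2 * i ⟩))
          × (k < + 0 → ∀ n → + 0 ≤ n → n ≤ - k - + 1 →
            γ ⟨ + 2 * n + + 1 ⟩ K.≈ (∑[ + 0 ≤ i ≤ n ] (K.- ι (brace (- k - i - + 1) (- k - n - + 1))) K.* γ ⟨ + 2 * i ⟩))))
theorem5p3 𝕂 ι ι-isHom γ r = mk⇔
  (λ γ∈𝓕 → (λ k r≡2k → Even.𝓕⇒Conditions 𝕂 ι ι-isHom γ k (≡.subst 𝓕ᵣ (≡.trans r≡2k (≡.sym (ℤ.+-identityʳ (+ 2 * k)))) γ∈𝓕))
         , (λ k r≡2k+1 → Odd.𝓕⇒Conditions 𝕂 ι ι-isHom γ k (≡.subst 𝓕ᵣ r≡2k+1 γ∈𝓕)))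
  from
  where
  𝓕ᵣ : ℤ → Set _
  𝓕ᵣ r = Over.𝓕 𝕂 r γ
  from : _ → 𝓕ᵣ r
  from (ev , od) with even-or-odd r
  ... | inj₁ (k , r≡2k)   = ≡.subst 𝓕ᵣ (≡.sym (≡.trans r≡2k (≡.sym (ℤ.+-identityʳ (+ 2 * k))))) (Even.Conditions⇒𝓕 𝕂 ι ι-isHom γ k (ev k r≡2k))
  ... | inj₂ (k , r≡2k+1) = ≡.subst 𝓕ᵣ (≡.sym r≡2k+1) (Odd.Conditions⇒𝓕 𝕂 ι ι-isHom γ k (od k r≡2k+1))
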